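{- Let $A=\bigoplus_{n\ge 0}A_n$ be a tower of algebras over $\mathbb{C}$. If the Grothendieck groups $G(A)$ and $K(A)$ of $A$ form a pair of graded dual Hopf algebras, then $\dim_{\mathbb{C}}(A_n)=r^n\,n!$ for all $n\ge 0$, where $r=\dim_{\mathbb{C}}(A_1)$.
   Context: A tower of algebras is a graded algebra $A=\bigoplus_{n\ge0}A_n$ over $\mathbb{C}$ with (external, associative) multiplication $\rho=(\rho_{m,n})$, $\rho_{m,n}\colon A_m\otimes A_n\to A_{m+n}$, such that: (1) each $A_n$ is itself a finite-dimensional associative algebra with its own internal multiplication and unit $1_n$, and $A_0\cong\mathbb{C}$; (2) each $\rho_{m,n}$ is an injective homomorphism of algebras (for the internal multiplications) sending $1_m\otimes 1_n$ to $1_{m+n}$; (3) $A_{m+n}$ is projective both as a left and as a right $A_m\otimes A_n$-module, where $A_m\otimes A_n$ acts through $\rho_{m,n}$ and internal multiplication in $A_{m+n}$. For a finite-dimensional algebra $B$, $G_0(B)$ is the Grothendieck group of finitely generated left $B$-modules (free abelian on classes of simple modules) and $K_0(B)$ is the Grothendieck group of finitely generated projective left $B$-modules (free abelian on classes of indecomposable projectives). Put $G(A)=\bigoplus_{n\ge0}G_0(A_n)$ and $K(A)=\bigoplus_{n\ge0}K_0(A_n)$. Both carry a multiplication and comultiplication given by $$[M][N]=\left[\mathrm{Ind}_{A_m\otimes A_n}^{A_{m+n}}M\otimes N\right]\ (M\text{ over }A_m,\ N\text{ over }A_n),\qquad \Delta([N])=\sum_{k+l=n}\left[\mathrm{Res}^{A_{n}}_{A_k\otimes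 A_l}N\right]\ (N\text{ over }A_n),$$ where induction is $A_{m+n}\otimes_{A_m\otimes A_n}-$ and restriction is along $\rho$, and where the class of an $A_k\otimes A_l$-module is viewed in $G_0(A_k)\otimes G_0(A_l)$ (resp. $K_0(A_k)\otimes K_0(A_l)$). The pairing $\langle\cdot,\cdot\rangle\colon K(A)\times G(A)\to\mathbb{Z}$ is $\langle [P],[M]\rangle=\dim_{\mathbb{C}}\mathrm{Hom}_{A_n}(P,M)$ if $P$ and $M$ are both modules over the same $A_n$, and $0$ if their degrees differ. "The Grothendieck groups form a pair of graded dual Hopf algebras" means that, with these operations, $G(A)$ and $K(A)$ are graded connected Hopf algebras over $\mathbb{Z}$ which are graded dual to each other under this pairing (the product of each is adjoint to the coproduct of the other). -}

module Defs where

open import Algebra.Bundles using (AbelianGroup; Ring; CommutativeRing)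
import Algebra.Construct.Flip.Op as Op
open import Algebra.Module.Bundles using (LeftModule)
import Algebra.Module.Construct.TensorUnit as TensorUnit
open import Algebra.Module.Morphism.Structures using (module LeftModuleMorphisms)
import Algebra.Morphism.Construct.Composition as Composition
import Algebra.Morphism.Construct.Identity as Identity
open import Algebra.Morphism.Structures using (IsRingHomomorphism; IsGroupHomomorphism; IsGroupIsomorphism)
import Algebra.Properties.AbelianGroup as AbelianGroupProperties
import Algebra.Properties.CommutativeMonoid.Sum as Sum
import Algebra.Properties.CommutativeSemigroup as CSProperties
import Algebra.Properties.Group as GroupProperties
import Algebra.Properties.Monoid.Mult as MonoidMult
open import Algebra.Structures using (IsRing)
open import Data.Empty using (⊥)
open import Data.Fin.Base using (Fin; zero; suc; combine; remQuot; toℕ)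
open import Data.Fin.Properties using (remQuot-combine; toℕ≤pred[n])
open import Data.Integer.Base as ℤ using (ℤ; +_; -[1+_]; 0ℤ)
import Data.Integer.Properties as ℤ
open import Data.Nat.Base as ℕ using (ℕ; zero; suc)
import Data.Nat.Properties as ℕ
open import Data.Product.Base using (Σ; ∃; _×_; _,_; proj₁; proj₂)
open import Data.Sum.Base using (inj₁; inj₂)
open import Function.Base using (id; _∘_)
open import Function.Definitions using (Injective; Surjective; Bijective)
open import Level using (Level; 0ℓ; _⊔_) renaming (suc to lsuc)
open import Relation.Binary.PropositionalEquality.Core using (_≡_; _≢_; refl; subst)

module Numbers where

  import Algebra.Consequences.Setoid
  import Algebra.Construct.DirectProduct as Product
  import Algebra.Solver.Ring.NaturalCoefficients.Default
  open import Data.Rational.Base as Q using (ℚ; 0ℚ; 1ℚ; ½; _+_; _*_; _-_; -_; ∣_∣; _<_; _≤_)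
  import Data.Rational.Properties as Q
  open import Data.Rational.Solver using (module +-*-Solver)
  open import Relation.Binary.PropositionalEquality.Core using (sym; trans; cong)

  module Small {I : Set} (T : ℕ → I → Set)
    (mono : ∀ {m n i} → m ℕ.≤ n → T n i → T m i) where

    -- f tends to 0, where T n i means that the index i lies beyond stage n.
    Vanishes : (I → ℚ) → Set
    Vanishes f = ∀ ε → 0ℚ < ε → ∃ λ N → ∀ i → T N i → ∣ f i ∣ < ε

    Bounded : (I → ℚ) → Set
    Bounded f = ∃ λ K → ∃ λ N → ∀ i → T N i → ∣ f i ∣ ≤ K

    resp : ∀ {f g} → (∀ i → f i ≡ g i) → Vanishes f → Vanishes g
    resp eq v ε ε>0 with v ε ε>0
    ... | N , h = N , λ i t → subst (λ z → ∣ z ∣ < ε) (eq i) (h i t)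

    zero-vanishes : Vanishes (λ _ → 0ℚ)
    zero-vanishes ε ε>0 = 0 , λ _ _ → ε>0

    neg : ∀ {f} → Vanishes f → Vanishes (λ i → - f i)
    neg {f} v ε ε>0 with v ε ε>0
    ... | N , h = N , λ i t → subst (_< ε) (sym (Q.∣-p∣≡∣p∣ (f i))) (h i t)

    add : ∀ {f g} → Vanishes f → Vanishes g → Vanishes (λ i → f i + g i)
    add {f} {g} v w ε ε>0 with v (½ * ε) ½ε>0 | w (½ * ε) ½ε>0
      where
      ½ε>0 : 0ℚ < ½ * ε
      ½ε>0 = subst (_< ½ * ε) (Q.*-zeroʳ ½) (Q.*-monoʳ-<-pos ½ ε>0)
    ... | M , h | N , k = M ℕ.⊔ N , λ i t →
      Q.≤-<-trans (Q.∣p+q∣≤∣p∣+∣q∣ (f i) (g i))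
        (subst (∣ f i ∣ + ∣ g i ∣ <_) halves
          (Q.+-mono-< (h i (mono (ℕ.m≤m⊔n M N) t)) (k i (mono (ℕ.m≤n⊔m M N) t))))
      where
      halves : ½ * ε + ½ * ε ≡ ε
      halves = trans (sym (Q.*-distribʳ-+ ε ½ ½)) (Q.*-identityˡ ε)

    scale : ∀ {f g} → Bounded f → Vanishes g → Vanishes (λ i → f i * g i)
    scale {f} {g} (K , M , b) v ε ε>0 with v (1/K′ * ε) 1/K′ε>0
      where
      instance
        K′-pos : Q.Positive (∣ K ∣ + 1ℚ)
        K′-pos = Q.nonNeg+pos⇒pos ∣ K ∣ {{Q.∣-∣-nonNeg K}} 1ℚ
        K′-nonZero : Q.NonZero (∣ K ∣ + 1ℚ)
        K′-nonZero = Q.pos⇒nonZero (∣ K ∣ + 1ℚ)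
      1/K′ = Q.1/ (∣ K ∣ + 1ℚ)
      1/K′ε>0 : 0ℚ < 1/K′ * ε
      1/K′ε>0 = subst (_< 1/K′ * ε) (Q.*-zeroʳ 1/K′)
        (Q.*-monoʳ-<-pos 1/K′ {{Q.1/pos⇒pos (∣ K ∣ + 1ℚ)}} ε>0)
    ... | N , h = M ℕ.⊔ N , λ i t → begin-strict
        ∣ f i * g i ∣             ≡⟨ Q.∣p*q∣≡∣p∣*∣q∣ (f i) (g i) ⟩
        ∣ f i ∣ * ∣ g i ∣         ≤⟨ Q.*-monoʳ-≤-nonNeg ∣ g i ∣ {{Q.∣-∣-nonNeg (g i)}} (f≤K′ i (mono (ℕ.m≤m⊔n M N) t)) ⟩
        K′ * ∣ g i ∣              <⟨ Q.*-monoʳ-<-pos K′ (h i (mono (ℕ.m≤n⊔m M N) t)) ⟩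
        K′ * (Q.1/ K′ * ε)        ≡⟨ sym (Q.*-assoc K′ (Q.1/ K′) ε) ⟩
        (K′ * Q.1/ K′) * ε        ≡⟨ cong (_* ε) (Q.*-inverseʳ K′) ⟩
        1ℚ * ε                    ≡⟨ Q.*-identityˡ ε ⟩
        ε                         ∎
      where
      open Q.≤-Reasoning
      K′ = ∣ K ∣ + 1ℚ
      instance
        K′-pos : Q.Positive K′
        K′-pos = Q.nonNeg+pos⇒pos ∣ K ∣ {{Q.∣-∣-nonNeg K}} 1ℚ
        K′-nonZero : Q.NonZero K′
        K′-nonZero = Q.pos⇒nonZero K′
      p≤∣p∣ : ∀ p → p ≤ ∣ p ∣
      p≤∣p∣ p with Q.≤-total 0ℚ p
      ... | inj₁ 0≤p = Q.≤-reflexive (sym (Q.0≤p⇒∣p∣≡p 0≤p))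
      ... | inj₂ p≤0 = Q.≤-trans p≤0 (Q.nonNegative⁻¹ ∣ p ∣ {{Q.∣-∣-nonNeg p}})
      f≤K′ : ∀ i → T M i → ∣ f i ∣ ≤ K′
      f≤K′ i t = begin
        ∣ f i ∣      ≤⟨ b i t ⟩
        K            ≤⟨ p≤∣p∣ K ⟩
        ∣ K ∣        ≡⟨ Q.+-identityʳ ∣ K ∣ ⟨
        ∣ K ∣ + 0ℚ   ≤⟨ Q.+-monoʳ-≤ ∣ K ∣ (Q.<⇒≤ (Q.positive⁻¹ 1ℚ)) ⟩
        K′           ∎

  module Null = Small ℕ._≤_ ℕ.≤-trans

  module Double = Small (λ N (mn : ℕ × ℕ) → N ℕ.≤ proj₁ mn × N ℕ.≤ proj₂ mn)
    (λ le (p , q) → ℕ.≤-trans le p , ℕ.≤-trans le q)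

  private
    module Identities where
      open +-*-Solver

      lemma₀ : ∀ a b → a ≡ (a - b) + b
      lemma₀ = solve 2 (λ a b → a := (a :- b) :+ b) refl

      lemma₁ : ∀ a b → - (a - b) ≡ b - a
      lemma₁ = solve 2 (λ a b → :- (a :- b) := b :- a) refl

      lemma₂ : ∀ a b → - (a - b) ≡ (- a) - (- b)
      lemma₂ = solve 2 (λ a b → :- (a :- b) := (:- a) :- (:- b)) refl

      lemma₃ : ∀ a b c → (a - b) + (b - c) ≡ a - c
      lemma₃ = solve 3 (λ a b c → (a :- b) :+ (b :- c) := a :- c) refl

      lemma₄ : ∀ a b c d → (a - b) + (c - d) ≡ (a + c) - (b + d)
      lemma₄ = solve 4 (λ a b c d → (a :- b) :+ (c :- d) := (a :+ c) :- (b :+ d)) refl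

      lemma₅ : ∀ a b c d → a * (c - d) + d * (a - b) ≡ a * c - b * d
      lemma₅ = solve 4 (λ a b c d → a :* (c :- d) :+ d :* (a :- b) := a :* c :- b :* d) refl

    open Identities

  -- Real numbers as Cauchy sequences of rationals; two sequences denote the same
  -- real when their difference tends to 0.
  IsCauchy : (ℕ → ℚ) → Set
  IsCauchy s = Double.Vanishes (λ mn → s (proj₁ mn) - s (proj₂ mn))

  record ℝ : Set where
    constructor _,cauchy_
    field
      seq    : ℕ → ℚ
      cauchy : IsCauchy seq

  open ℝ

  infix 4 _≈ℝ_

  _≈ℝ_ : ℝ → ℝ → Set
  x ≈ℝ y = Null.Vanishes (λ n → seq x n - seq y n)

  cauchy⇒bounded : ∀ {s} → IsCauchy s → Null.Bounded s
  cauchy⇒bounded {s} c with c 1ℚ (Q.positive⁻¹ 1ℚ)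
  ... | N , h = 1ℚ + ∣ s N ∣ , N , λ n N≤n → begin
      ∣ s n ∣                   ≡⟨ cong ∣_∣ (lemma₀ (s n) (s N)) ⟩
      ∣ (s n - s N) + s N ∣     ≤⟨ Q.∣p+q∣≤∣p∣+∣q∣ (s n - s N) (s N) ⟩
      ∣ s n - s N ∣ + ∣ s N ∣   ≤⟨ Q.+-monoˡ-≤ ∣ s N ∣ (Q.<⇒≤ (h (n , N) (N≤n , ℕ.≤-refl))) ⟩
      1ℚ + ∣ s N ∣              ∎
    where open Q.≤-Reasoning

  +-cauchy : ∀ {s t} → IsCauchy s → IsCauchy t → IsCauchy (λ n → s n + t n)
  +-cauchy {s} {t} c d = Double.resp
    (λ { (m , n) → lemma₄ (s m) (s n) (t m) (t n) })
    (Double.add c d)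

  *-cauchy : ∀ {s t} → IsCauchy s → IsCauchy t → IsCauchy (λ n → s n * t n)
  *-cauchy {s} {t} c d = Double.resp (λ mn → lemma₅ (s (proj₁ mn)) (s (proj₂ mn)) (t (proj₁ mn)) (t (proj₂ mn)))
    (Double.add
      (Double.scale {f = λ mn → s (proj₁ mn)} {g = λ mn → t (proj₁ mn) - t (proj₂ mn)} s-bounded d)
      (Double.scale {f = λ mn → t (proj₂ mn)} {g = λ mn → s (proj₁ mn) - s (proj₂ mn)} t-bounded c))
    where
    s-bounded : Double.Bounded (λ mn → s (proj₁ mn))
    s-bounded = let (K , N , h) = cauchy⇒bounded {s} c in K , N , λ mn le → h (proj₁ mn) (proj₁ le)
    t-bounded : Double.Bounded (λ mn → t (proj₂ mn))
    t-bounded = let (K , N , h) = cauchy⇒bounded {t} d in K , N , λ mn le → h (proj₂ mn) (proj₂ le)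

  neg-cauchy : ∀ {s} → IsCauchy s → IsCauchy (λ n → - s n)
  neg-cauchy {s} c = Double.resp
    (λ { (m , n) → lemma₂ (s m) (s n) })
    (Double.neg c)

  fromℚ : ℚ → ℝ
  fromℚ q = (λ _ → q) ,cauchy Double.resp (λ _ → sym (Q.+-inverseʳ q)) Double.zero-vanishes

  _+ℝ_ _*ℝ_ : ℝ → ℝ → ℝ
  (s ,cauchy c) +ℝ (t ,cauchy d) = (λ n → s n + t n) ,cauchy +-cauchy {s} {t} c d
  (s ,cauchy c) *ℝ (t ,cauchy d) = (λ n → s n * t n) ,cauchy *-cauchy {s} {t} c d

  -ℝ_ : ℝ → ℝ
  -ℝ (s ,cauchy c) = (λ n → - s n) ,cauchy neg-cauchy {s} c

  pointwise : ∀ {x y} → (∀ n → seq x n ≡ seq y n) → x ≈ℝ y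
  pointwise {x} {y} eq = Null.resp
    (λ n → sym (trans (cong (_- seq y n) (eq n)) (Q.+-inverseʳ (seq y n)))) Null.zero-vanishes

  ℝ-commutativeRing : CommutativeRing 0ℓ 0ℓ
  ℝ-commutativeRing = record
    { Carrier = ℝ ; _≈_ = _≈ℝ_ ; _+_ = _+ℝ_ ; _*_ = _*ℝ_ ; -_ = -ℝ_
    ; 0# = fromℚ 0ℚ ; 1# = fromℚ 1ℚ
    ; isCommutativeRing = record
      { isRing = record
        { +-isAbelianGroup = record
          { isGroup = record
            { isMonoid = record
              { isSemigroup = record
                { isMagma = record
                  { isEquivalence = record
                    { refl  = λ {x} → pointwise {x} {x} (λ _ → refl)
                    ; sym   = λ {x} {y} p → Null.resp
                        (λ n → lemma₁ (seq x n) (seq y n))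
                        (Null.neg p)
                    ; trans = λ {x} {y} {z} p q → Null.resp
                        (λ n → lemma₃ (seq x n) (seq y n) (seq z n))
                        (Null.add p q)
                    }
                  ; ∙-cong = λ {x} {y} {u} {v} p q → Null.resp
                      (λ n → lemma₄
                               (seq x n) (seq y n) (seq u n) (seq v n))
                      (Null.add p q)
                  }
                ; assoc = λ x y z → pointwise {(x +ℝ y) +ℝ z} {x +ℝ (y +ℝ z)} (λ n → Q.+-assoc (seq x n) (seq y n) (seq z n))
                }
              ; identity = (λ x → pointwise {fromℚ 0ℚ +ℝ x} {x} (λ n → Q.+-identityˡ (seq x n)))
                         , (λ x → pointwise {x +ℝ fromℚ 0ℚ} {x} (λ n → Q.+-identityʳ (seq x n)))
              }
            ; inverse = (λ x → pointwise {(-ℝ x) +ℝ x} {fromℚ 0ℚ} (λ n → Q.+-inverseˡ (seq x n)))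
                      , (λ x → pointwise {x +ℝ (-ℝ x)} {fromℚ 0ℚ} (λ n → Q.+-inverseʳ (seq x n)))
            ; ⁻¹-cong = λ {x} {y} p → Null.resp
                (λ n → lemma₂ (seq x n) (seq y n))
                (Null.neg p)
            }
          ; comm = λ x y → pointwise {x +ℝ y} {y +ℝ x} (λ n → Q.+-comm (seq x n) (seq y n))
          }
        ; *-cong = λ {x} {y} {u} {v} p q → Null.resp
            (λ n → lemma₅
                     (seq x n) (seq y n) (seq u n) (seq v n))
            (Null.add (Null.scale {f = seq x} (cauchy⇒bounded {seq x} (cauchy x)) q)
                      (Null.scale {f = seq v} (cauchy⇒bounded {seq v} (cauchy v)) p))
        ; *-assoc = λ x y z → pointwise {(x *ℝ y) *ℝ z} {x *ℝ (y *ℝ z)} (λ n → Q.*-assoc (seq x n) (seq y n) (seq z n))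
        ; *-identity = (λ x → pointwise {fromℚ 1ℚ *ℝ x} {x} (λ n → Q.*-identityˡ (seq x n)))
                     , (λ x → pointwise {x *ℝ fromℚ 1ℚ} {x} (λ n → Q.*-identityʳ (seq x n)))
        ; distrib = (λ x y z → pointwise {x *ℝ (y +ℝ z)} {(x *ℝ y) +ℝ (x *ℝ z)} (λ n → Q.*-distribˡ-+ (seq x n) (seq y n) (seq z n)))
                  , (λ x y z → pointwise {(y +ℝ z) *ℝ x} {(y *ℝ x) +ℝ (z *ℝ x)} (λ n → Q.*-distribʳ-+ (seq x n) (seq y n) (seq z n)))
        }
      ; *-comm = λ x y → pointwise {x *ℝ y} {y *ℝ x} (λ n → Q.*-comm (seq x n) (seq y n))
      }
    }

  -- R[X]/(X² - d), with (a , b) standing for a + b X.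
  module _ (R : CommutativeRing 0ℓ 0ℓ) (d : CommutativeRing.Carrier R) where
    private
      module R = CommutativeRing R
      module R² = CommutativeRing (Product.commutativeRing R R)
      open R² using (Carrier; _≈_)
      open Algebra.Consequences.Setoid R².setoid using (comm∧distrˡ⇒distr; comm∧idˡ⇒id)
      open Algebra.Solver.Ring.NaturalCoefficients.Default R.commutativeSemiring

      _·_ : Carrier → Carrier → Carrier
      (a , b) · (a′ , b′) = a R.* a′ R.+ d R.* (b R.* b′) , a R.* b′ R.+ b R.* a′

      1√ : Carrier
      1√ = R.1# , R.0#

      ·-cong : ∀ {x y u v} → x ≈ y → u ≈ v → (x · u) ≈ (y · v)
      ·-cong (p , q) (r , s) = R.+-cong (R.*-cong p r) (R.*-congˡ (R.*-cong q s)) , R.+-cong (R.*-cong p s) (R.*-cong q r)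

      ·-comm : ∀ x y → (x · y) ≈ (y · x)
      ·-comm (a , b) (a′ , b′) =
        R.+-cong (R.*-comm a a′) (R.*-congˡ (R.*-comm b b′)) ,
        solve 4 (λ a b a′ b′ → a :* b′ :+ b :* a′ := a′ :* b :+ b′ :* a) R.refl a b a′ b′

      ·-identityˡ : ∀ x → (1√ · x) ≈ x
      ·-identityˡ (a , b) =
        solve 3 (λ d a b → con 1 :* a :+ d :* (con 0 :* b) := a) R.refl d a b ,
        solve 2 (λ a b → con 1 :* b :+ con 0 :* a := b) R.refl a b

      ·-assoc : ∀ x y z → ((x · y) · z) ≈ (x · (y · z))
      ·-assoc (a , b) (a′ , b′) (a″ , b″) =
        solve 7 (λ d a b a′ b′ a″ b″ →
          (a :* a′ :+ d :* (b :* b′)) :* a″ :+ d :* ((a :* b′ :+ b :* a′) :* b″) :=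
          a :* (a′ :* a″ :+ d :* (b′ :* b″)) :+ d :* (b :* (a′ :* b″ :+ b′ :* a″)))
          R.refl d a b a′ b′ a″ b″ ,
        solve 7 (λ d a b a′ b′ a″ b″ →
          (a :* a′ :+ d :* (b :* b′)) :* b″ :+ (a :* b′ :+ b :* a′) :* a″ :=
          a :* (a′ :* b″ :+ b′ :* a″) :+ b :* (a′ :* a″ :+ d :* (b′ :* b″)))
          R.refl d a b a′ b′ a″ b″

      ·-distribˡ : ∀ x y z → (x · (y R².+ z)) ≈ ((x · y) R².+ (x · z))
      ·-distribˡ (a , b) (a′ , b′) (a″ , b″) =
        solve 7 (λ d a b a′ b′ a″ b″ →
          a :* (a′ :+ a″) :+ d :* (b :* (b′ :+ b″)) :=
          (a :* a′ :+ d :* (b :* b′)) :+ (a :* a″ :+ d :* (b :* b″)))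
          R.refl d a b a′ b′ a″ b″ ,
        solve 6 (λ a b a′ b′ a″ b″ →
          a :* (b′ :+ b″) :+ b :* (a′ :+ a″) := (a :* b′ :+ b :* a′) :+ (a :* b″ :+ b :* a″))
          R.refl a b a′ b′ a″ b″

    adjoin-√ : CommutativeRing 0ℓ 0ℓ
    adjoin-√ = record
      { _*_ = _·_
      ; 1#  = 1√
      ; isCommutativeRing = record
        { isRing = record
          { +-isAbelianGroup = R².+-isAbelianGroup
          ; *-cong     = ·-cong
          ; *-assoc    = ·-assoc
          ; *-identity = comm∧idˡ⇒id ·-comm ·-identityˡ
          ; distrib    = comm∧distrˡ⇒distr R².+-cong ·-comm ·-distribˡ
          }
        ; *-comm = ·-comm
        }
      }

  ℂ : CommutativeRing 0ℓ 0ℓ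
  ℂ = adjoin-√ ℝ-commutativeRing (-ℝ fromℚ 1ℚ)

open Numbers public using (ℂ)

open import Data.Nat.Base using (_+_; _∸_)

infixl 6 _⊕_
infix 8 ⊖_

data Expr {x : Level} (X : Set x) : Set x where
  [_]  : X → Expr X
  𝟎    : Expr X
  _⊕_  : Expr X → Expr X → Expr X
  ⊖_   : Expr X → Expr X

-- The abelian group generated by X subject to s = t whenever s ∼ t.
module Presentation {x r : Level} {X : Set x} (_∼_ : Expr X → Expr X → Set r) where

  infix 4 _≈_

  data _≈_ : Expr X → Expr X → Set (x ⊔ r) where
    relation   : ∀ {s t} → s ∼ t → s ≈ t
    refl       : ∀ {s} → s ≈ s
    sym        : ∀ {s t} → s ≈ t → t ≈ s
    trans      : ∀ {s t u} → s ≈ t → t ≈ u → s ≈ u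
    ⊕-cong     : ∀ {s s′ t t′} → s ≈ s′ → t ≈ t′ → s ⊕ t ≈ s′ ⊕ t′
    ⊖-cong     : ∀ {s s′} → s ≈ s′ → ⊖ s ≈ ⊖ s′
    ⊕-assoc    : ∀ s t u → (s ⊕ t) ⊕ u ≈ s ⊕ (t ⊕ u)
    ⊕-comm     : ∀ s t → s ⊕ t ≈ t ⊕ s
    ⊕-identity : ∀ s → 𝟎 ⊕ s ≈ s
    ⊖-inverse  : ∀ s → ⊖ s ⊕ s ≈ 𝟎

  group : AbelianGroup x (x ⊔ r)
  group = record
    { Carrier = Expr X
    ; _≈_ = _≈_
    ; _∙_ = _⊕_
    ; ε = 𝟎
    ; _⁻¹ = ⊖_
    ; isAbelianGroup = record
      { isGroup = record
        { isMonoid = record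
          { isSemigroup = record
            { isMagma = record
              { isEquivalence = record { refl = refl ; sym = sym ; trans = trans }
              ; ∙-cong = ⊕-cong
              }
            ; assoc = ⊕-assoc
            }
          ; identity = ⊕-identity , λ s → trans (⊕-comm s 𝟎) (⊕-identity s)
          }
        ; inverse = ⊖-inverse , λ s → trans (⊕-comm s (⊖ s)) (⊖-inverse s)
        ; ⁻¹-cong = ⊖-cong
        }
      ; comm = ⊕-comm
      }
    }

-- The additive extension of a map on generators.
module Evaluation {x g ℓ : Level} {X : Set x} (G : AbelianGroup g ℓ) where
  private module G = AbelianGroup G

  eval : (X → G.Carrier) → Expr X → G.Carrier
  eval f [ x ]   = f x
  eval f 𝟎       = G.ε
  eval f (s ⊕ t) = eval f s G.∙ eval f t
  eval f (⊖ s)   = eval f s G.⁻¹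

  module _ {r : Level} {_∼_ : Expr X → Expr X → Set r} where
    open Presentation _∼_

    eval-cong : ∀ {f} → (∀ {s t} → s ∼ t → eval f s G.≈ eval f t) →
                ∀ {s t} → s ≈ t → eval f s G.≈ eval f t
    eval-cong h (relation p)   = h p
    eval-cong h refl           = G.refl
    eval-cong h (sym p)        = G.sym (eval-cong h p)
    eval-cong h (trans p q)    = G.trans (eval-cong h p) (eval-cong h q)
    eval-cong h (⊕-cong p q)   = G.∙-cong (eval-cong h p) (eval-cong h q)
    eval-cong h (⊖-cong p)     = G.⁻¹-cong (eval-cong h p)
    eval-cong h (⊕-assoc s t u) = G.assoc _ _ _
    eval-cong h (⊕-comm s t)   = G.comm _ _
    eval-cong h (⊕-identity s) = G.identityˡ _
    eval-cong h (⊖-inverse s)  = G.inverseˡ _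

  record IsAdditive (f : Expr X → G.Carrier) : Set (x ⊔ ℓ) where
    field
      𝟎-homo : f 𝟎 G.≈ G.ε
      ⊕-homo : ∀ s t → f (s ⊕ t) G.≈ f s G.∙ f t
      ⊖-homo : ∀ s → f (⊖ s) G.≈ f s G.⁻¹

  eval-isAdditive : ∀ f → IsAdditive (eval f)
  eval-isAdditive f = record { 𝟎-homo = G.refl ; ⊕-homo = λ _ _ → G.refl ; ⊖-homo = λ _ → G.refl }

  additive-unique : ∀ f h → IsAdditive f → IsAdditive h →
                    (∀ x → f [ x ] G.≈ h [ x ]) → ∀ t → f t G.≈ h t
  additive-unique f h F H eq = go
    where
    module F = IsAdditive F
    module H = IsAdditive H
    go : ∀ t → f t G.≈ h t
    go [ x ]   = eq x
    go 𝟎       = G.trans F.𝟎-homo (G.sym H.𝟎-homo)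
    go (s ⊕ t) = G.trans (F.⊕-homo s t) (G.trans (G.∙-cong (go s) (go t)) (G.sym (H.⊕-homo s t)))
    go (⊖ s)   = G.trans (F.⊖-homo s) (G.trans (G.⁻¹-cong (go s)) (G.sym (H.⊖-homo s)))

  ∙-isAdditive : ∀ {f h} → IsAdditive f → IsAdditive h → IsAdditive (λ t → f t G.∙ h t)
  ∙-isAdditive F H = record
    { 𝟎-homo = G.trans (G.∙-cong F.𝟎-homo H.𝟎-homo) (G.identityˡ G.ε)
    ; ⊕-homo = λ s t → G.trans (G.∙-cong (F.⊕-homo s t) (H.⊕-homo s t)) (interchange _ _ _ _)
    ; ⊖-homo = λ s → G.trans (G.∙-cong (F.⊖-homo s) (H.⊖-homo s)) (⁻¹-∙-comm _ _)
    }
    where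
    module F = IsAdditive F
    module H = IsAdditive H
    open CSProperties G.commutativeSemigroup using (interchange)
    open AbelianGroupProperties G using (⁻¹-∙-comm)

  ⁻¹-isAdditive : ∀ {f} → IsAdditive f → IsAdditive (λ t → f t G.⁻¹)
  ⁻¹-isAdditive F = record
    { 𝟎-homo = G.trans (G.⁻¹-cong F.𝟎-homo) ε⁻¹≈ε
    ; ⊕-homo = λ s t → G.trans (G.⁻¹-cong (F.⊕-homo s t)) (G.sym (⁻¹-∙-comm _ _))
    ; ⊖-homo = λ s → G.⁻¹-cong (F.⊖-homo s)
    }
    where
    module F = IsAdditive F
    open AbelianGroupProperties G using (⁻¹-∙-comm; ε⁻¹≈ε)

  ε-isAdditive : IsAdditive (λ _ → G.ε)
  ε-isAdditive = record
    { 𝟎-homo = G.refl ; ⊕-homo = λ _ _ → G.sym (G.identityˡ G.ε) ; ⊖-homo = λ _ → G.sym ε⁻¹≈ε }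
    where open AbelianGroupProperties G using (ε⁻¹≈ε)

open Evaluation

Mod : Ring 0ℓ 0ℓ → Set₁
Mod R = LeftModule R 0ℓ 0ℓ

regular : (R : Ring 0ℓ 0ℓ) → Mod R
regular R = TensorUnit.leftModule {R = R}

-- A map of abelian groups that preserves _∙_ preserves ε and _⁻¹.
module _ {a ℓa b ℓb : Level} (G : AbelianGroup a ℓa) (H : AbelianGroup b ℓb) where
  private
    module G = AbelianGroup G
    module H = AbelianGroup H
    open GroupProperties H.group using (identityˡ-unique; inverseˡ-unique)

  mkGroupHom : (f : G.Carrier → H.Carrier) → (∀ {x y} → x G.≈ y → f x H.≈ f y) →
               (∀ x y → f (x G.∙ y) H.≈ f x H.∙ f y) → IsGroupHomomorphism G.rawGroup H.rawGroup f
  mkGroupHom f f-cong f-homo = record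
    { isMonoidHomomorphism = record
      { isMagmaHomomorphism = record
        { isRelHomomorphism = record { cong = f-cong }
        ; homo = f-homo
        }
      ; ε-homo = ε-homo
      }
    ; ⁻¹-homo = λ x → inverseˡ-unique _ _
        (H.trans (H.sym (f-homo _ _)) (H.trans (f-cong (G.inverseˡ x)) ε-homo))
    }
    where
    ε-homo : f G.ε H.≈ H.ε
    ε-homo = identityˡ-unique _ _ (H.trans (H.sym (f-homo G.ε G.ε)) (f-cong (G.identityˡ G.ε)))

module _ {r ℓr g ℓg : Level} (R : Ring r ℓr) (G : AbelianGroup g ℓg) where
  private
    module R = Ring R
    module G = AbelianGroup G

  mkModule : (_·_ : R.Carrier → G.Carrier → G.Carrier) →
             (∀ {r s x y} → r R.≈ s → x G.≈ y → (r · x) G.≈ (s · y)) →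
             (∀ r s x → ((r R.* s) · x) G.≈ (r · (s · x))) →
             (∀ x → (R.1# · x) G.≈ x) →
             (∀ r x y → (r · (x G.∙ y)) G.≈ ((r · x) G.∙ (r · y))) →
             (∀ x r s → ((r R.+ s) · x) G.≈ ((r · x) G.∙ (s · x))) → LeftModule R g ℓg
  mkModule _·_ cong assoc identity distribˡ distribʳ = record
    { Carrierᴹ = G.Carrier
    ; _≈ᴹ_ = G._≈_
    ; _+ᴹ_ = G._∙_
    ; _*ₗ_ = _·_
    ; 0ᴹ = G.ε
    ; -ᴹ_ = G._⁻¹
    ; isLeftModule = record
      { isLeftSemimodule = record
        { +ᴹ-isCommutativeMonoid = G.isCommutativeMonoid
        ; isPreleftSemimodule = record
          { *ₗ-cong = cong
          ; *ₗ-zeroˡ = λ x → identityˡ-unique _ _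
              (G.trans (G.sym (distribʳ x _ _)) (cong (R.+-identityˡ R.0#) G.refl))
          ; *ₗ-distribʳ = distribʳ
          ; *ₗ-identityˡ = identity
          ; *ₗ-assoc = assoc
          ; *ₗ-zeroʳ = λ r → identityˡ-unique _ _
              (G.trans (G.sym (distribˡ r _ _)) (cong R.refl (G.identityˡ G.ε)))
          ; *ₗ-distribˡ = distribˡ
          }
        }
      ; -ᴹ‿cong = G.⁻¹-cong
      ; -ᴹ‿inverse = G.inverse
      }
    }
    where open GroupProperties G.group using (identityˡ-unique)

record RingHom (R S : Ring 0ℓ 0ℓ) : Set where
  field
    ⟦_⟧                : Ring.Carrier R → Ring.Carrier S
    isRingHomomorphism : IsRingHomomorphism (Ring.rawRing R) (Ring.rawRing S) ⟦_⟧
  open IsRingHomomorphism isRingHomomorphism public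

record Hom {R : Ring 0ℓ 0ℓ} (M N : Mod R) : Set where
  private
    module M = LeftModule M
    module N = LeftModule N
  open LeftModuleMorphisms M.rawLeftModule N.rawLeftModule
  field
    ⟦_⟧         : M.Carrierᴹ → N.Carrierᴹ
    isModuleHom : IsLeftModuleHomomorphism ⟦_⟧
  open IsLeftModuleHomomorphism isModuleHom public

module _ {R : Ring 0ℓ 0ℓ} (M N : Mod R) where
  private
    module R = Ring R
    module M = LeftModule M
    module N = LeftModule N

  mkHom : (f : M.Carrierᴹ → N.Carrierᴹ) → (∀ {x y} → x M.≈ᴹ y → f x N.≈ᴹ f y) →
          (∀ x y → f (x M.+ᴹ y) N.≈ᴹ f x N.+ᴹ f y) →
          (∀ r x → f (r M.*ₗ x) N.≈ᴹ r N.*ₗ f x) → Hom M N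
  mkHom f f-cong +-homo *-homo = record
    { ⟦_⟧ = f
    ; isModuleHom = record
      { +ᴹ-isGroupHomomorphism = mkGroupHom M.+ᴹ-abelianGroup N.+ᴹ-abelianGroup f f-cong +-homo
      ; *ₗ-homo = *-homo
      }
    }

module _ {R S : Ring 0ℓ 0ℓ} (φ : RingHom R S) where
  private
    module R = Ring R
    module φ = RingHom φ

  restrict : Mod S → Mod R
  restrict M = mkModule R M.+ᴹ-abelianGroup (λ r m → φ.⟦ r ⟧ M.*ₗ m)
    (λ p q → M.*ₗ-cong (φ.⟦⟧-cong p) q)
    (λ r s x → M.≈ᴹ-trans (M.*ₗ-congʳ (φ.*-homo r s)) (M.*ₗ-assoc _ _ x))
    (λ x → M.≈ᴹ-trans (M.*ₗ-congʳ φ.1#-homo) (M.*ₗ-identityˡ x))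
    (λ r → M.*ₗ-distribˡ φ.⟦ r ⟧)
    (λ x r s → M.≈ᴹ-trans (M.*ₗ-congʳ (φ.+-homo r s)) (M.*ₗ-distribʳ x _ _))
    where module M = LeftModule M

module _ {R : Ring 0ℓ 0ℓ} where

  IsSurjective IsInjective : {M N : Mod R} → Hom M N → Set
  IsSurjective {M} {N} f = Surjective (LeftModule._≈ᴹ_ M) (LeftModule._≈ᴹ_ N) (Hom.⟦_⟧ f)
  IsInjective  {M} {N} f = Injective  (LeftModule._≈ᴹ_ M) (LeftModule._≈ᴹ_ N) (Hom.⟦_⟧ f)

  record ShortExact (L M N : Mod R) : Set where
    private
      module M = LeftModule M
      module N = LeftModule N
    field
      incl            : Hom L M
      proj            : Hom M N
      incl-injective  : IsInjective incl
      proj-surjective : IsSurjective proj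
      ker⊆im          : ∀ m → Hom.⟦ proj ⟧ m N.≈ᴹ N.0ᴹ → ∃ λ l → Hom.⟦ incl ⟧ l M.≈ᴹ m
      im⊆ker          : ∀ l → Hom.⟦ proj ⟧ (Hom.⟦ incl ⟧ l) N.≈ᴹ N.0ᴹ

  record IsProjective (P : Mod R) : Set₁ where
    field
      lift : (M N : Mod R) (g : Hom M N) → IsSurjective g → (f : Hom P N) →
        Σ (Hom P M) λ h → ∀ p → LeftModule._≈ᴹ_ N (Hom.⟦ g ⟧ (Hom.⟦ h ⟧ p)) (Hom.⟦ f ⟧ p)

open IsProjective using (lift)

module _ {R S T : Ring 0ℓ 0ℓ} where

  infixr 9 _∘ᴿ_

  _∘ᴿ_ : RingHom S T → RingHom R S → RingHom R T
  ψ ∘ᴿ φ = record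
    { ⟦_⟧ = ψ.⟦_⟧ ∘ φ.⟦_⟧
    ; isRingHomomorphism = Composition.isRingHomomorphism (Ring.trans T) φ.isRingHomomorphism ψ.isRingHomomorphism
    }
    where
    module ψ = RingHom ψ
    module φ = RingHom φ

idᴿ : (R : Ring 0ℓ 0ℓ) → RingHom R R
idᴿ R = record { ⟦_⟧ = id ; isRingHomomorphism = Identity.isRingHomomorphism (Ring.rawRing R) (Ring.refl R) }

-- M ⊗ N modulo (m ◂ r) ⊗ n = m ⊗ (r ▸ n) for r in R.
module Tensor {a ℓa b ℓb r : Level} (M : AbelianGroup a ℓa) (N : AbelianGroup b ℓb) {R : Set r}
  (_◂_ : AbelianGroup.Carrier M → R → AbelianGroup.Carrier M)
  (_▸_ : R → AbelianGroup.Carrier N → AbelianGroup.Carrier N) where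
  private
    module M = AbelianGroup M
    module N = AbelianGroup N

  infix 7 _⊗_

  _⊗_ : M.Carrier → N.Carrier → Expr (M.Carrier × N.Carrier)
  m ⊗ n = [ m , n ]

  data _∼_ : Expr (M.Carrier × N.Carrier) → Expr (M.Carrier × N.Carrier) → Set (a ⊔ ℓa ⊔ b ⊔ ℓb ⊔ r) where
    ⊗-cong     : ∀ {m m′ n n′} → m M.≈ m′ → n N.≈ n′ → (m ⊗ n) ∼ (m′ ⊗ n′)
    ⊗-distribˡ : ∀ m n n′ → (m ⊗ (n N.∙ n′)) ∼ ((m ⊗ n) ⊕ (m ⊗ n′))
    ⊗-distribʳ : ∀ n m m′ → ((m M.∙ m′) ⊗ n) ∼ ((m ⊗ n) ⊕ (m′ ⊗ n))
    balanced   : ∀ m r n → ((m ◂ r) ⊗ n) ∼ (m ⊗ (r ▸ n))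

  open Presentation _∼_ public

  record IsBalanced {g ℓ : Level} (G : AbelianGroup g ℓ)
                    (f : M.Carrier × N.Carrier → AbelianGroup.Carrier G) : Set (a ⊔ ℓa ⊔ b ⊔ ℓb ⊔ r ⊔ ℓ) where
    private module G = AbelianGroup G
    field
      f-cong     : ∀ {m m′ n n′} → m M.≈ m′ → n N.≈ n′ → f (m , n) G.≈ f (m′ , n′)
      f-distribˡ : ∀ m n n′ → f (m , (n N.∙ n′)) G.≈ f (m , n) G.∙ f (m , n′)
      f-distribʳ : ∀ n m m′ → f ((m M.∙ m′) , n) G.≈ f (m , n) G.∙ f (m′ , n)
      f-balanced : ∀ m r n → f ((m ◂ r) , n) G.≈ f (m , (r ▸ n))

    induced-cong : ∀ {s t} → s ≈ t → eval G f s G.≈ eval G f t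
    induced-cong = eval-cong G λ where
      (⊗-cong p q)        → f-cong p q
      (⊗-distribˡ m n n′) → f-distribˡ m n n′
      (⊗-distribʳ n m m′) → f-distribʳ n m m′
      (balanced m r n)    → f-balanced m r n

  ⊗-isBalanced : ∀ {f : M.Carrier → M.Carrier} {h : N.Carrier → N.Carrier} → 
    (∀ {m m′} → m M.≈ m′ → f m M.≈ f m′) → (∀ m m′ → f (m M.∙ m′) M.≈ f m M.∙ f m′) →
    (∀ {n n′} → n N.≈ n′ → h n N.≈ h n′) → (∀ n n′ → h (n N.∙ n′) N.≈ h n N.∙ h n′) →
    (∀ m r → f (m ◂ r) M.≈ (f m ◂ r)) → (∀ r n → h (r ▸ n) N.≈ (r ▸ h n)) →
    IsBalanced group (λ mn → f (proj₁ mn) ⊗ h (proj₂ mn))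
  ⊗-isBalanced f-cong f-homo h-cong h-homo f-◂ h-▸ = record
    { f-cong     = λ p q → relation (⊗-cong (f-cong p) (h-cong q))
    ; f-distribˡ = λ m n n′ → trans (relation (⊗-cong M.refl (h-homo n n′))) (relation (⊗-distribˡ _ _ _))
    ; f-distribʳ = λ n m m′ → trans (relation (⊗-cong (f-homo m m′) N.refl)) (relation (⊗-distribʳ _ _ _))
    ; f-balanced = λ m r n → trans (relation (⊗-cong (f-◂ m r) N.refl))
        (trans (relation (balanced _ _ _)) (relation (⊗-cong M.refl (N.sym (h-▸ r n)))))
    }

-- Left modules M over B and N over C, where B and C share the central scalars R:
-- M ⊠ N is the tensor product over R, with (b ⊗ c)(m ⊗ n) = bm ⊗ cn.
module External {b ℓb c ℓc r : Level} (B : Ring b ℓb) (C : Ring c ℓc) {R : Set r}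
  (β : R → Ring.Carrier B) (γ : R → Ring.Carrier C)
  (β-central : ∀ r x → Ring._≈_ B (Ring._*_ B x (β r)) (Ring._*_ B (β r) x))
  (γ-central : ∀ r x → Ring._≈_ C (Ring._*_ C x (γ r)) (Ring._*_ C (γ r) x)) where
  private
    module B = Ring B
    module C = Ring C

  module _ {m ℓm n ℓn : Level} (M : LeftModule B m ℓm) (N : LeftModule C n ℓn) where
    private
      module M = LeftModule M
      module N = LeftModule N

    module ⊠ = Tensor M.+ᴹ-abelianGroup N.+ᴹ-abelianGroup (λ m r → β r M.*ₗ m) (λ r n → γ r N.*ₗ n)
    open ⊠ using (group; _⊗_; _≈_; refl; sym; trans; relation; ⊗-cong; ⊗-distribˡ; ⊗-distribʳ; balanced)
    private module G = AbelianGroup group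

    translate : B.Carrier → C.Carrier → G.Carrier → G.Carrier
    translate b c = eval group (λ mn → (b M.*ₗ proj₁ mn) ⊗ (c N.*ₗ proj₂ mn))

    act : Expr (B.Carrier × C.Carrier) → G.Carrier → G.Carrier
    act s t = eval group (λ bc → translate (proj₁ bc) (proj₂ bc) t) s

    translate-cong : ∀ b c {s t} → s ≈ t → translate b c s ≈ translate b c t
    translate-cong b c = ⊠.IsBalanced.induced-cong (⊠.⊗-isBalanced
      M.*ₗ-congˡ (M.*ₗ-distribˡ b) N.*ₗ-congˡ (N.*ₗ-distribˡ c)
      (λ m r → M.≈ᴹ-trans (M.≈ᴹ-sym (M.*ₗ-assoc _ _ _)) (M.≈ᴹ-trans (M.*ₗ-congʳ (β-central r b)) (M.*ₗ-assoc _ _ _)))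
      (λ r n → N.≈ᴹ-trans (N.≈ᴹ-sym (N.*ₗ-assoc _ _ _)) (N.≈ᴹ-trans (N.*ₗ-congʳ (γ-central r c)) (N.*ₗ-assoc _ _ _))))

    act-isAdditive : ∀ s → IsAdditive group (act s)
    act-isAdditive [ _ ]   = eval-isAdditive group _
    act-isAdditive 𝟎       = ε-isAdditive group
    act-isAdditive (s ⊕ t) = ∙-isAdditive group (act-isAdditive s) (act-isAdditive t)
    act-isAdditive (⊖ s)   = ⁻¹-isAdditive group (act-isAdditive s)

    act-congˡ : ∀ s {t t′} → t ≈ t′ → act s t ≈ act s t′
    act-congˡ s p = additive-unique group _ _ (eval-isAdditive group _) (eval-isAdditive group _)
      (λ bc → translate-cong (proj₁ bc) (proj₂ bc) p) s

    act-identity : ∀ t → act [ B.1# , C.1# ] t ≈ t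
    act-identity = additive-unique group _ _ (eval-isAdditive group _)
      (record { 𝟎-homo = refl ; ⊕-homo = λ _ _ → refl ; ⊖-homo = λ _ → refl })
      (λ mn → relation (⊗-cong (M.*ₗ-identityˡ (proj₁ mn)) (N.*ₗ-identityˡ (proj₂ mn))))

  regularᴮ = TensorUnit.leftModule {R = B}
  regularᶜ = TensorUnit.leftModule {R = C}

  module _ {m ℓm n ℓn : Level} (M : LeftModule B m ℓm) (N : LeftModule C n ℓn) where
    private
      module M = LeftModule M
      module N = LeftModule N
      module BC = ⊠ regularᴮ regularᶜ
    open ⊠ M N using (group; _⊗_; _≈_; refl; sym; trans; relation; ⊗-cong; ⊗-distribˡ; ⊗-distribʳ; balanced)

    act-congʳ : ∀ {s s′} → s BC.≈ s′ → ∀ t → act M N s t ≈ act M N s′ t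
    act-congʳ p t = BC.IsBalanced.induced-cong {G = group} {f = λ bc → translate M N (proj₁ bc) (proj₂ bc) t} (record
      { f-cong = λ p q → unique (λ mn → relation (⊗-cong (M.*ₗ-congʳ p) (N.*ₗ-congʳ q))) t
      ; f-distribˡ = λ b c c′ → additive-unique group _ _
          (eval-isAdditive group _) (∙-isAdditive group (eval-isAdditive group _) (eval-isAdditive group _))
          (λ mn → trans (relation (⊗-cong M.≈ᴹ-refl (N.*ₗ-distribʳ _ _ _))) (relation (⊗-distribˡ _ _ _))) t
      ; f-distribʳ = λ c b b′ → additive-unique group _ _
          (eval-isAdditive group _) (∙-isAdditive group (eval-isAdditive group _) (eval-isAdditive group _))
          (λ mn → trans (relation (⊗-cong (M.*ₗ-distribʳ _ _ _) N.≈ᴹ-refl)) (relation (⊗-distribʳ _ _ _))) t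
      ; f-balanced = λ b r c → unique (λ mn → trans (relation (⊗-cong (M.*ₗ-assoc _ _ _) N.≈ᴹ-refl))
          (trans (relation (balanced _ _ _)) (relation (⊗-cong M.≈ᴹ-refl (N.≈ᴹ-sym (N.*ₗ-assoc _ _ _)))))) t
      }) p
      where
      unique : ∀ {f h} → (∀ mn → f mn ≈ h mn) → ∀ t → eval group f t ≈ eval group h t
      unique = additive-unique group _ _ (eval-isAdditive group _) (eval-isAdditive group _)

    act-assoc : ∀ s s′ t → act M N (act regularᴮ regularᶜ s s′) t ≈ act M N s (act M N s′ t)
    act-assoc s s′ t = additive-unique group
      (λ s → act M N (act regularᴮ regularᶜ s s′) t) (λ s → act M N s (act M N s′ t)) (record { 𝟎-homo = refl ; ⊕-homo = λ _ _ → refl ; ⊖-homo = λ _ → refl })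
       (record { 𝟎-homo = refl ; ⊕-homo = λ _ _ → refl ; ⊖-homo = λ _ → refl })
      (λ { (b , c) → additive-unique group
        (λ s′ → act M N (translate regularᴮ regularᶜ b c s′) t) (λ s′ → translate M N b c (act M N s′ t)) (record { 𝟎-homo = refl ; ⊕-homo = λ _ _ → refl ; ⊖-homo = λ _ → refl })
       (record { 𝟎-homo = refl ; ⊕-homo = λ _ _ → refl ; ⊖-homo = λ _ → refl })
        (λ { (b′ , c′) → additive-unique group
          (translate M N (b B.* b′) (c C.* c′)) (λ t → translate M N b c (translate M N b′ c′ t)) (record { 𝟎-homo = refl ; ⊕-homo = λ _ _ → refl ; ⊖-homo = λ _ → refl })
       (record { 𝟎-homo = refl ; ⊕-homo = λ _ _ → refl ; ⊖-homo = λ _ → refl })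
          (λ mn → relation (⊗-cong (M.*ₗ-assoc b b′ _) (N.*ₗ-assoc c c′ _))) t }) s′ }) s

  ring : Ring (b ⊔ c) (b ⊔ ℓb ⊔ c ⊔ ℓc ⊔ r)
  ring = record
    { Carrier = Expr (B.Carrier × C.Carrier)
    ; _≈_ = _≈_
    ; _+_ = _⊕_
    ; _*_ = act regularᴮ regularᶜ
    ; -_ = ⊖_
    ; 0# = 𝟎
    ; 1# = [ B.1# , C.1# ]
    ; isRing = record
      { +-isAbelianGroup = AbelianGroup.isAbelianGroup group
      ; *-cong = λ {s} {s′} {t} {t′} p q → trans (act-congʳ regularᴮ regularᶜ p t) (act-congˡ regularᴮ regularᶜ s′ q)
      ; *-assoc = act-assoc regularᴮ regularᶜ
      ; *-identity = act-identity regularᴮ regularᶜ , additive-unique group _ _ (eval-isAdditive group _)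
          (record { 𝟎-homo = refl ; ⊕-homo = λ _ _ → refl ; ⊖-homo = λ _ → refl })
          (λ bc → relation (⊗-cong (B.*-identityʳ (proj₁ bc)) (C.*-identityʳ (proj₂ bc))))
      ; distrib = (λ s → IsAdditive.⊕-homo (act-isAdditive regularᴮ regularᶜ s)) , λ _ _ _ → refl
      }
    }
    where open ⊠ regularᴮ regularᶜ

  _⊠ᴹ_ : ∀ {m ℓm n ℓn} (M : LeftModule B m ℓm) (N : LeftModule C n ℓn) →
         LeftModule ring (m ⊔ n) (m ⊔ ℓm ⊔ n ⊔ ℓn ⊔ r)
  M ⊠ᴹ N = mkModule ring group (act M N)
    (λ {s} {s′} {t} {t′} p q → trans (act-congʳ M N p t) (act-congˡ M N s′ q))
    (act-assoc M N)
    (act-identity M N)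
    (λ s → IsAdditive.⊕-homo (act-isAdditive M N s))
    (λ _ _ _ → refl)
    where open ⊠ M N

-- S ⊗_R M as a left S-module, for φ : R → S.
module Induction {R S : Ring 0ℓ 0ℓ} (φ : RingHom R S) (M : Mod R) where
  private
    module S = Ring S
    module φ = RingHom φ
    module M = LeftModule M

  open Tensor S.+-abelianGroup M.+ᴹ-abelianGroup (λ s r → s S.* φ.⟦ r ⟧) (λ r m → r M.*ₗ m) public

  private
    _·_ : S.Carrier → Expr (S.Carrier × M.Carrierᴹ) → Expr (S.Carrier × M.Carrierᴹ)
    s · t = eval group (λ xm → (s S.* proj₁ xm) ⊗ proj₂ xm) t

    homo : (s : S.Carrier) → IsAdditive group (s ·_)
    homo s = eval-isAdditive group _

    ·-congʳ : ∀ s {t t′} → t ≈ t′ → s · t ≈ s · t′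
    ·-congʳ s = IsBalanced.induced-cong (⊗-isBalanced {f = s S.*_} {h = id} S.*-congˡ (S.distribˡ s) id (λ _ _ → M.≈ᴹ-refl)
      (λ x r → S.sym (S.*-assoc _ _ _)) (λ _ _ → M.≈ᴹ-refl))

  ind : Mod S
  ind = mkModule S group _·_
    (λ {s} {s′} {t} {t′} p q → trans
      (additive-unique group _ _ (homo s) (homo s′) (λ xm → relation (⊗-cong (S.*-congʳ p) M.≈ᴹ-refl)) t)
      (·-congʳ s′ q))
    (λ s s′ t → additive-unique group ((s S.* s′) ·_) (λ t → s · (s′ · t)) (homo _)
      (record { 𝟎-homo = refl ; ⊕-homo = λ _ _ → refl ; ⊖-homo = λ _ → refl })
      (λ xm → relation (⊗-cong (S.*-assoc _ _ _) M.≈ᴹ-refl)) t)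
    (additive-unique group (S.1# ·_) id (homo _)
      (record { 𝟎-homo = refl ; ⊕-homo = λ _ _ → refl ; ⊖-homo = λ _ → refl })
      (λ xm → relation (⊗-cong (S.*-identityˡ _) M.≈ᴹ-refl)))
    (λ s t t′ → refl)
    (λ t s s′ → additive-unique group ((s S.+ s′) ·_) (λ t → (s · t) ⊕ (s′ · t)) (homo _)
      (∙-isAdditive group (homo s) (homo s′))
      (λ xm → trans (relation (⊗-cong (S.distribʳ _ _ _) M.≈ᴹ-refl)) (relation (⊗-distribʳ _ _ _))) t)

module _ {g ℓg h ℓh : Level} (G : AbelianGroup g ℓg) (H : AbelianGroup h ℓh) where
  private
    module G = AbelianGroup G
    module H = AbelianGroup H

  sum-homo : (f : G.Carrier → H.Carrier) → (∀ {x y} → x G.≈ y → f x H.≈ f y) →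
             (∀ x y → f (x G.∙ y) H.≈ f x H.∙ f y) →
             ∀ {n} (x : Fin n → G.Carrier) → f (Sum.sum G.commutativeMonoid x) H.≈ Sum.sum H.commutativeMonoid (f ∘ x)
  sum-homo f f-cong f-homo = go
    where
    open IsGroupHomomorphism (mkGroupHom G H f f-cong f-homo) using (ε-homo)
    go : ∀ {n} (x : Fin n → G.Carrier) → f (Sum.sum G.commutativeMonoid x) H.≈ Sum.sum H.commutativeMonoid (f ∘ x)
    go {zero}  x = ε-homo
    go {suc n} x = H.trans (f-homo _ _) (H.∙-congˡ (go (x ∘ suc)))

module LinearCombination {R : Ring 0ℓ 0ℓ} (M : Mod R) where
  private module R = Ring R
  open LeftModule M
  open Sum +ᴹ-commutativeMonoid using (sum; sum-cong-≋; ∑-distrib-+)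

  combination : {n : ℕ} → (Fin n → R.Carrier) → (Fin n → Carrierᴹ) → Carrierᴹ
  combination c g = sum (λ i → c i *ₗ g i)

  private
    zero-combination : ∀ {n} (g : Fin n → Carrierᴹ) → 0ᴹ ≈ᴹ combination (λ _ → R.0#) g
    zero-combination {zero}  g = ≈ᴹ-refl
    zero-combination {suc n} g = ≈ᴹ-trans (≈ᴹ-sym (+ᴹ-identityˡ _)) (+ᴹ-cong (≈ᴹ-sym (*ₗ-zeroˡ _)) (zero-combination (g ∘ suc)))

  module Span {n : ℕ} (g : Fin n → Carrierᴹ) where

    InSpan : Carrierᴹ → Set
    InSpan m = Σ (Fin n → R.Carrier) λ c → m ≈ᴹ combination c g

    resp : ∀ {x y} → x ≈ᴹ y → InSpan x → InSpan y
    resp p (c , q) = c , ≈ᴹ-trans (≈ᴹ-sym p) q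

    +-closed : ∀ {x y} → InSpan x → InSpan y → InSpan (x +ᴹ y)
    +-closed (c , p) (d , q) = (λ i → c i R.+ d i) ,
      ≈ᴹ-trans (+ᴹ-cong p q) (≈ᴹ-trans (≈ᴹ-sym (∑-distrib-+ (λ i → c i *ₗ g i) (λ i → d i *ₗ g i)))
        (sum-cong-≋ (λ i → ≈ᴹ-sym (*ₗ-distribʳ (g i) (c i) (d i)))))

    *-closed : ∀ r {x} → InSpan x → InSpan (r *ₗ x)
    *-closed r (c , p) = (λ i → r R.* c i) ,
      ≈ᴹ-trans (*ₗ-congˡ p) (≈ᴹ-trans (sum-homo +ᴹ-abelianGroup +ᴹ-abelianGroup (r *ₗ_) *ₗ-congˡ (*ₗ-distribˡ r) (λ i → c i *ₗ g i))
        (sum-cong-≋ (λ i → ≈ᴹ-sym (*ₗ-assoc r (c i) (g i)))))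

    0-closed : InSpan 0ᴹ
    0-closed = (λ _ → R.0#) , zero-combination g

    neg-closed : ∀ {x} → InSpan x → InSpan (-ᴹ x)
    neg-closed {x} p = resp (inverseˡ-unique _ _
      (≈ᴹ-trans (+ᴹ-cong ≈ᴹ-refl (≈ᴹ-sym (*ₗ-identityˡ x)))
        (≈ᴹ-trans (≈ᴹ-sym (*ₗ-distribʳ x _ _)) (≈ᴹ-trans (*ₗ-congʳ (R.-‿inverseˡ R.1#)) (*ₗ-zeroˡ x)))))
      (*-closed (R.- R.1#) p)
      where open GroupProperties +ᴹ-group using (inverseˡ-unique)

    sum-closed : ∀ {k} (f : Fin k → Carrierᴹ) → (∀ i → InSpan (f i)) → InSpan (sum f)
    sum-closed {zero}  f p = 0-closed
    sum-closed {suc k} f p = +-closed (p zero) (sum-closed (f ∘ suc) (p ∘ suc))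

  generator∈span : ∀ {n} (g : Fin n → Carrierᴹ) i → Span.InSpan g (g i)
  generator∈span {suc n} g zero    = (λ { zero → R.1# ; (suc _) → R.0# }) ,
    ≈ᴹ-trans (≈ᴹ-sym (+ᴹ-identityʳ _)) (+ᴹ-cong (≈ᴹ-sym (*ₗ-identityˡ _)) (zero-combination (g ∘ suc)))
  generator∈span {suc n} g (suc i) = let (c , p) = generator∈span (g ∘ suc) i in
    (λ { zero → R.0# ; (suc j) → c j }) ,
    ≈ᴹ-trans (≈ᴹ-sym (+ᴹ-identityˡ _)) (+ᴹ-cong (≈ᴹ-sym (*ₗ-zeroˡ _)) p)

open LinearCombination using (combination; generator∈span; module Span)

record IsFinitelyGenerated {R : Ring 0ℓ 0ℓ} (M : Mod R) : Set where
  constructor finitelyGenerated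
  field
    size       : ℕ
    generators : Fin size → LeftModule.Carrierᴹ M
    spans      : ∀ m → Span.InSpan M generators m

restrict-fg : {R S : Ring 0ℓ 0ℓ} (φ : RingHom R S) → IsFinitelyGenerated (restrict φ (regular S)) →
              (M : Mod S) → IsFinitelyGenerated M → IsFinitelyGenerated (restrict φ M)
restrict-fg {R} {S} φ (finitelyGenerated p b b-spans) M (finitelyGenerated q g g-spans) = finitelyGenerated (p ℕ.* q) bg λ m →
  let (c , m≈) = g-spans m in resp (M.≈ᴹ-sym m≈) (sum-closed _ (λ i → multiple (c i) i))
  where
  module S = Ring S
  module M = LeftModule M
  module φ = RingHom φ
  φM = restrict φ M
  bg : Fin (p ℕ.* q) → M.Carrierᴹ
  bg x = b (proj₁ (remQuot q x)) M.*ₗ g (proj₂ (remQuot {p} q x))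
  open Span φM bg
  product : ∀ j i → InSpan (b j M.*ₗ g i)
  product j i = subst (λ x → InSpan (b (proj₁ x) M.*ₗ g (proj₂ x))) (remQuot-combine {p} {q} j i)
    (generator∈span φM bg (combine j i))
  multiple : ∀ s i → InSpan (s M.*ₗ g i)
  multiple s i = let (c , s≈) = b-spans s in
    resp (M.≈ᴹ-sym (M.≈ᴹ-trans (M.*ₗ-congʳ s≈)
      (sum-homo S.+-abelianGroup M.+ᴹ-abelianGroup (M._*ₗ g i) M.*ₗ-congʳ (M.*ₗ-distribʳ (g i)) (λ j → φ.⟦ c j ⟧ S.* b j))))
    (sum-closed _ (λ j → resp (M.≈ᴹ-sym (M.*ₗ-assoc _ _ _)) (*-closed (c j) (product j i))))

ind-fg : {R S : Ring 0ℓ 0ℓ} (φ : RingHom R S) (M : Mod R) → IsFinitelyGenerated M → IsFinitelyGenerated (Induction.ind φ M)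
ind-fg {R} {S} φ M (finitelyGenerated n g g-spans) = finitelyGenerated n 1⊗g spans
  where
  module S = Ring S
  module M = LeftModule M
  module φ = RingHom φ
  open Induction φ M
  1⊗g : Fin n → Expr (S.Carrier × M.Carrierᴹ)
  1⊗g i = S.1# ⊗ g i
  open Span ind 1⊗g
  pure : ∀ m → InSpan (S.1# ⊗ m)
  pure m = let (c , m≈) = g-spans m in
    resp (sym (trans (relation (⊗-cong S.refl m≈))
      (sum-homo M.+ᴹ-abelianGroup group (S.1# ⊗_) (relation ∘ ⊗-cong S.refl) (λ x y → relation (⊗-distribˡ _ x y)) (λ i → c i M.*ₗ g i))))
    (sum-closed _ (λ i → resp
      (trans (relation (⊗-cong (S.trans (S.*-identityʳ _) (S.sym (S.*-identityˡ _))) M.≈ᴹ-refl)) (relation (balanced _ _ _)))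
      (*-closed φ.⟦ c i ⟧ (generator∈span ind 1⊗g i))))
  spans : ∀ t → InSpan t
  spans [ s , m ] = resp (relation (⊗-cong (S.*-identityʳ s) M.≈ᴹ-refl)) (*-closed s (pure m))
  spans 𝟎         = 0-closed
  spans (s ⊕ t)   = +-closed (spans s) (spans t)
  spans (⊖ s)     = neg-closed (spans s)

module _ {R : Ring 0ℓ 0ℓ} (P N : Mod R) where
  private
    module P = LeftModule P
    module N = LeftModule N

  homGroup : AbelianGroup 0ℓ 0ℓ
  homGroup = record
    { Carrier = Hom P N
    ; _≈_ = λ f h → ∀ p → Hom.⟦ f ⟧ p N.≈ᴹ Hom.⟦ h ⟧ p
    ; _∙_ = λ f h → mkHom P N (λ p → Hom.⟦ f ⟧ p N.+ᴹ Hom.⟦ h ⟧ p)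
        (λ e → N.+ᴹ-cong (Hom.⟦⟧-cong f e) (Hom.⟦⟧-cong h e))
        (λ x y → N.≈ᴹ-trans (N.+ᴹ-cong (Hom.+ᴹ-homo f x y) (Hom.+ᴹ-homo h x y)) (interchange _ _ _ _))
        (λ r x → N.≈ᴹ-trans (N.+ᴹ-cong (Hom.*ₗ-homo f r x) (Hom.*ₗ-homo h r x)) (N.≈ᴹ-sym (N.*ₗ-distribˡ r _ _)))
    ; ε = mkHom P N (λ _ → N.0ᴹ) (λ _ → N.≈ᴹ-refl)
        (λ _ _ → N.≈ᴹ-sym (N.+ᴹ-identityˡ _)) (λ r _ → N.≈ᴹ-sym (N.*ₗ-zeroʳ r))
    ; _⁻¹ = λ f → mkHom P N (λ p → N.-ᴹ Hom.⟦ f ⟧ p)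
        (λ e → N.-ᴹ‿cong (Hom.⟦⟧-cong f e))
        (λ x y → N.≈ᴹ-trans (N.-ᴹ‿cong (Hom.+ᴹ-homo f x y)) (N.≈ᴹ-sym (⁻¹-∙-comm _ _)))
        (λ r x → N.≈ᴹ-trans (N.≈ᴹ-sym (Hom.-ᴹ-homo f (r P.*ₗ x))) (N.≈ᴹ-trans
          (Hom.⟦⟧-cong f (P.≈ᴹ-sym (*-neg r x))) (N.≈ᴹ-trans (Hom.*ₗ-homo f r _) (N.*ₗ-congˡ (Hom.-ᴹ-homo f x)))))
    ; isAbelianGroup = record
      { isGroup = record
        { isMonoid = record
          { isSemigroup = record
            { isMagma = record
              { isEquivalence = record
                { refl = λ _ → N.≈ᴹ-refl ; sym = λ e p → N.≈ᴹ-sym (e p) ; trans = λ e e′ p → N.≈ᴹ-trans (e p) (e′ p) }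
              ; ∙-cong = λ e e′ p → N.+ᴹ-cong (e p) (e′ p)
              }
            ; assoc = λ _ _ _ _ → N.+ᴹ-assoc _ _ _
            }
          ; identity = (λ _ _ → N.+ᴹ-identityˡ _) , (λ _ _ → N.+ᴹ-identityʳ _)
          }
        ; inverse = (λ _ _ → N.-ᴹ‿inverseˡ _) , (λ _ _ → N.-ᴹ‿inverseʳ _)
        ; ⁻¹-cong = λ e p → N.-ᴹ‿cong (e p)
        }
      ; comm = λ _ _ _ → N.+ᴹ-comm _ _
      }
    }
    where
    open CSProperties (AbelianGroup.commutativeSemigroup N.+ᴹ-abelianGroup) using (interchange)
    open AbelianGroupProperties N.+ᴹ-abelianGroup using (⁻¹-∙-comm)
    *-neg : ∀ r x → r P.*ₗ (P.-ᴹ x) P.≈ᴹ P.-ᴹ (r P.*ₗ x)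
    *-neg r x = IsGroupHomomorphism.⁻¹-homo
      (mkGroupHom P.+ᴹ-abelianGroup P.+ᴹ-abelianGroup (r P.*ₗ_) P.*ₗ-congˡ (P.*ₗ-distribˡ r)) x

-- Hom_R(P , N) is a module over any ring B acting on N by R-linear endomorphisms.
module _ {R B : Ring 0ℓ 0ℓ} (P N : Mod R) (_▷ : Ring.Carrier B → Hom N N) where
  private
    module B = Ring B
    module N = LeftModule N
    infixr 8 _·_
    _·_ : B.Carrier → N.Carrierᴹ → N.Carrierᴹ
    b · n = Hom.⟦ b ▷ ⟧ n

  homModule : (∀ {b c} → b B.≈ c → ∀ n → b · n N.≈ᴹ c · n) →
              (∀ b c n → (b B.* c) · n N.≈ᴹ b · c · n) → (∀ n → B.1# · n N.≈ᴹ n) →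
              (∀ n b c → (b B.+ c) · n N.≈ᴹ b · n N.+ᴹ c · n) → Mod B
  homModule cong assoc identity distribʳ = mkModule B (homGroup P N)
    (λ b f → mkHom P N (λ p → b · Hom.⟦ f ⟧ p)
      (λ e → Hom.⟦⟧-cong (b ▷) (Hom.⟦⟧-cong f e))
      (λ x y → N.≈ᴹ-trans (Hom.⟦⟧-cong (b ▷) (Hom.+ᴹ-homo f x y)) (Hom.+ᴹ-homo (b ▷) _ _))
      (λ r x → N.≈ᴹ-trans (Hom.⟦⟧-cong (b ▷) (Hom.*ₗ-homo f r x)) (Hom.*ₗ-homo (b ▷) r _)))
    (λ {b} {c} b≈c e p → N.≈ᴹ-trans (Hom.⟦⟧-cong (b ▷) (e p)) (cong b≈c _))
    (λ b c f p → assoc b c _)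
    (λ f p → identity _)
    (λ b f h p → Hom.+ᴹ-homo (b ▷) _ _)
    (λ f b c p → distribʳ _ b c)

-- Hom_R(S , N) with (s f)(x) = f(x s).
coinduced : {R S : Ring 0ℓ 0ℓ} (φ : RingHom R S) → Mod R → Mod S
coinduced {R} {S} φ N = mkModule S (homGroup φS N)
  (λ s f → mkHom φS N (λ x → Hom.⟦ f ⟧ (x S.* s))
    (λ e → Hom.⟦⟧-cong f (S.*-congʳ e))
    (λ x y → N.≈ᴹ-trans (Hom.⟦⟧-cong f (S.distribʳ _ _ _)) (Hom.+ᴹ-homo f _ _))
    (λ r x → N.≈ᴹ-trans (Hom.⟦⟧-cong f (S.*-assoc _ _ _)) (Hom.*ₗ-homo f r _)))
  (λ {s} {s′} {f} {h} s≈s′ e x → N.≈ᴹ-trans (e _) (Hom.⟦⟧-cong h (S.*-congˡ s≈s′)))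
  (λ s s′ f x → Hom.⟦⟧-cong f (S.sym (S.*-assoc _ _ _)))
  (λ f x → Hom.⟦⟧-cong f (S.*-identityʳ x))
  (λ s f h x → N.≈ᴹ-refl)
  (λ f s s′ x → N.≈ᴹ-trans (Hom.⟦⟧-cong f (S.distribˡ _ _ _)) (Hom.+ᴹ-homo f _ _))
  where
  module S = Ring S
  module N = LeftModule N
  φS = restrict φ (regular S)

module _ {R S : Ring 0ℓ 0ℓ} (φ : RingHom R S) where
  private
    module R = Ring R
    module S = Ring S
    module φ = RingHom φ

  restrictHom : {M N : Mod S} → Hom M N → Hom (restrict φ M) (restrict φ N)
  restrictHom {M} {N} f = mkHom (restrict φ M) (restrict φ N) (Hom.⟦ f ⟧) (Hom.⟦⟧-cong f) (Hom.+ᴹ-homo f)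
    (λ r → Hom.*ₗ-homo f φ.⟦ r ⟧)

  restrict-projective : IsProjective (restrict φ (regular S)) → (P : Mod S) → IsProjective P → IsProjective (restrict φ P)
  lift (restrict-projective S-proj P P-proj) M N g g-surj f = h , λ p → N.≈ᴹ-trans
      (proj₂ lifted p S.1#) (Hom.⟦⟧-cong f (P.*ₗ-identityˡ p))
    where
    module P = LeftModule P
    module M = LeftModule M
    module N = LeftModule N
    φS = restrict φ (regular S)
    postcompose : Hom φS M → Hom φS N
    postcompose u = mkHom φS N (λ x → Hom.⟦ g ⟧ (Hom.⟦ u ⟧ x)) (λ e → Hom.⟦⟧-cong g (Hom.⟦⟧-cong u e))
      (λ x y → N.≈ᴹ-trans (Hom.⟦⟧-cong g (Hom.+ᴹ-homo u x y)) (Hom.+ᴹ-homo g _ _))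
      (λ r x → N.≈ᴹ-trans (Hom.⟦⟧-cong g (Hom.*ₗ-homo u r x)) (Hom.*ₗ-homo g _ _))
    G : Hom (coinduced φ M) (coinduced φ N)
    G = mkHom (coinduced φ M) (coinduced φ N) postcompose (λ e x → Hom.⟦⟧-cong g (e x))
      (λ u v x → Hom.+ᴹ-homo g _ _) (λ s u x → N.≈ᴹ-refl)
    G-surj : IsSurjective G
    G-surj v = let (u , gu≈v) = lift S-proj M N g g-surj v in
      u , λ e x → N.≈ᴹ-trans (Hom.⟦⟧-cong g (e x)) (gu≈v x)
    F : Hom P (coinduced φ N)
    F = mkHom P (coinduced φ N)
      (λ p → mkHom φS N (λ x → Hom.⟦ f ⟧ (x P.*ₗ p)) (λ e → Hom.⟦⟧-cong f (P.*ₗ-congʳ e))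
        (λ x y → N.≈ᴹ-trans (Hom.⟦⟧-cong f (P.*ₗ-distribʳ p x y)) (Hom.+ᴹ-homo f _ _))
        (λ r x → N.≈ᴹ-trans (Hom.⟦⟧-cong f (P.*ₗ-assoc _ x p)) (Hom.*ₗ-homo f r _)))
      (λ e x → Hom.⟦⟧-cong f (P.*ₗ-congˡ e))
      (λ p q x → N.≈ᴹ-trans (Hom.⟦⟧-cong f (P.*ₗ-distribˡ x p q)) (Hom.+ᴹ-homo f _ _))
      (λ s p x → Hom.⟦⟧-cong f (P.≈ᴹ-sym (P.*ₗ-assoc x s p)))
    lifted = lift P-proj (coinduced φ M) (coinduced φ N) G G-surj F
    module H = Hom (proj₁ lifted)
    h : Hom (restrict φ P) M
    h = mkHom (restrict φ P) M (λ p → Hom.⟦ H.⟦ p ⟧ ⟧ S.1#) (λ e → H.⟦⟧-cong e S.1#)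
      (λ p q → H.+ᴹ-homo p q S.1#)
      (λ r p → M.≈ᴹ-trans (H.*ₗ-homo φ.⟦ r ⟧ p S.1#) (M.≈ᴹ-trans
        (Hom.⟦⟧-cong H.⟦ p ⟧ (S.trans (S.*-identityˡ _) (S.sym (S.*-identityʳ _))))
        (Hom.*ₗ-homo H.⟦ p ⟧ r S.1#)))

  ind-projective : (P : Mod R) → IsProjective P → IsProjective (Induction.ind φ P)
  lift (ind-projective P P-proj) M N g g-surj f = h , additive-unique N.+ᴹ-abelianGroup _ _
      (record { 𝟎-homo = Hom.0ᴹ-homo g ; ⊕-homo = λ _ _ → Hom.+ᴹ-homo g _ _ ; ⊖-homo = λ _ → Hom.-ᴹ-homo g _ })
      (record { 𝟎-homo = Hom.0ᴹ-homo f ; ⊕-homo = Hom.+ᴹ-homo f ; ⊖-homo = Hom.-ᴹ-homo f })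
      (λ { (s , p) → N.≈ᴹ-trans (Hom.*ₗ-homo g s _) (N.≈ᴹ-trans (N.*ₗ-congˡ (proj₂ lifted p))
        (N.≈ᴹ-trans (N.≈ᴹ-sym (Hom.*ₗ-homo f s _)) (Hom.⟦⟧-cong f (relation (⊗-cong (S.*-identityʳ s) P.≈ᴹ-refl))))) })
    where
    module P = LeftModule P
    module M = LeftModule M
    module N = LeftModule N
    open Induction φ P
    f₁ : Hom P (restrict φ N)
    f₁ = mkHom P (restrict φ N) (λ p → Hom.⟦ f ⟧ (S.1# ⊗ p)) (λ e → Hom.⟦⟧-cong f (relation (⊗-cong S.refl e)))
      (λ p q → N.≈ᴹ-trans (Hom.⟦⟧-cong f (relation (⊗-distribˡ _ p q))) (Hom.+ᴹ-homo f _ _))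
      (λ r p → N.≈ᴹ-trans (Hom.⟦⟧-cong f (trans (sym (relation (balanced _ r p)))
          (relation (⊗-cong (S.trans (S.*-identityˡ _) (S.sym (S.*-identityʳ _))) P.≈ᴹ-refl))))
        (Hom.*ₗ-homo f _ _))
    lifted = lift P-proj (restrict φ M) (restrict φ N) (restrictHom {M} {N} g) g-surj f₁
    module H = Hom (proj₁ lifted)
    value : S.Carrier × P.Carrierᴹ → M.Carrierᴹ
    value sp = proj₁ sp M.*ₗ H.⟦ proj₂ sp ⟧
    h : Hom ind M
    h = mkHom ind M (eval M.+ᴹ-abelianGroup value)
      (IsBalanced.induced-cong {G = M.+ᴹ-abelianGroup} {f = value} (record
        { f-cong = λ e e′ → M.*ₗ-cong e (H.⟦⟧-cong e′)
        ; f-distribˡ = λ s p q → M.≈ᴹ-trans (M.*ₗ-congˡ (H.+ᴹ-homo p q)) (M.*ₗ-distribˡ s _ _)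
        ; f-distribʳ = λ p s s′ → M.*ₗ-distribʳ _ s s′
        ; f-balanced = λ s r p → M.≈ᴹ-trans (M.*ₗ-assoc _ _ _) (M.*ₗ-congˡ (M.≈ᴹ-sym (H.*ₗ-homo r p)))
        }))
      (λ _ _ → M.≈ᴹ-refl)
      (λ s t → additive-unique M.+ᴹ-abelianGroup
        (λ t → eval M.+ᴹ-abelianGroup value (LeftModule._*ₗ_ ind s t)) (λ t → s M.*ₗ eval M.+ᴹ-abelianGroup value t)
        (record { 𝟎-homo = M.≈ᴹ-refl ; ⊕-homo = λ _ _ → M.≈ᴹ-refl ; ⊖-homo = λ _ → M.≈ᴹ-refl })
        (record { 𝟎-homo = M.*ₗ-zeroʳ s ; ⊕-homo = λ _ _ → M.*ₗ-distribˡ s _ _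
                ; ⊖-homo = λ _ → IsGroupHomomorphism.⁻¹-homo
                    (mkGroupHom M.+ᴹ-abelianGroup M.+ᴹ-abelianGroup (s M.*ₗ_) M.*ₗ-congˡ (M.*ₗ-distribˡ s)) _ })
        (λ _ → M.*ₗ-assoc s _ _) t)

module _ (R S : Ring 0ℓ 0ℓ) where
  private
    module R = Ring R
    module S = Ring S

  mkRingHom : (f : R.Carrier → S.Carrier) → (∀ {x y} → x R.≈ y → f x S.≈ f y) →
              (∀ x y → f (x R.+ y) S.≈ f x S.+ f y) → (∀ x y → f (x R.* y) S.≈ f x S.* f y) →
              f R.1# S.≈ S.1# → RingHom R S
  mkRingHom f f-cong +-homo *-homo 1-homo = record
    { ⟦_⟧ = f
    ; isRingHomomorphism = record
      { isSemiringHomomorphism = record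
        { isNearSemiringHomomorphism = record
          { +-isMonoidHomomorphism = isMonoidHomomorphism ; *-homo = *-homo }
        ; 1#-homo = 1-homo
        }
      ; -‿homo = ⁻¹-homo
      }
    }
    where open IsGroupHomomorphism (mkGroupHom R.+-abelianGroup S.+-abelianGroup f f-cong +-homo)

_ᵒᵖ : Ring 0ℓ 0ℓ → Ring 0ℓ 0ℓ
_ᵒᵖ = Op.ring

opHom : {R S : Ring 0ℓ 0ℓ} → RingHom R S → RingHom (R ᵒᵖ) (S ᵒᵖ)
opHom {R} {S} φ = mkRingHom (R ᵒᵖ) (S ᵒᵖ) φ.⟦_⟧ φ.⟦⟧-cong φ.+-homo (λ x y → φ.*-homo y x) φ.1#-homo
  where module φ = RingHom φ

module Over (k : CommutativeRing 0ℓ 0ℓ) where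
  private module k = CommutativeRing k

  record Algebra : Set₁ where
    field
      ring      : Ring 0ℓ 0ℓ
      ι         : RingHom k.ring ring
    open Ring ring public
    field
      ι-central : ∀ z x → x * RingHom.⟦ ι ⟧ z ≈ RingHom.⟦ ι ⟧ z * x

  base : Algebra
  base = record { ring = k.ring ; ι = idᴿ k.ring ; ι-central = λ z x → k.*-comm x z }

  record AlgHom (A B : Algebra) : Set where
    private
      module A = Algebra A
      module B = Algebra B
    field
      ringHom : RingHom A.ring B.ring
    open RingHom ringHom public
    field
      ι-homo : ∀ z → ⟦ RingHom.⟦ A.ι ⟧ z ⟧ B.≈ RingHom.⟦ B.ι ⟧ z

  AlgMod : Algebra → Set₁
  AlgMod A = Mod (Algebra.ring A)

  underlying : (A : Algebra) → AlgMod A → Mod k.ring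
  underlying A = restrict (Algebra.ι A)

  IsBasis : (V : Mod k.ring) {d : ℕ} → (Fin d → LeftModule.Carrierᴹ V) → Set
  IsBasis V {d} b = (∀ v → Σ (Fin d → k.Carrier) λ c → v V.≈ᴹ combination V c b)
                  × (∀ c → combination V c b V.≈ᴹ V.0ᴹ → ∀ i → c i k.≈ k.0#)
    where module V = LeftModule V

  HasDimension : Mod k.ring → ℕ → Set
  HasDimension V d = Σ (Fin d → LeftModule.Carrierᴹ V) (IsBasis V)

  -- Hom_A(P , M) as a k-module.
  homSpace : (A : Algebra) → AlgMod A → AlgMod A → Mod k.ring
  homSpace A P M = homModule {B = k.ring} P M
    (λ z → mkHom M M (λ m → ι.⟦ z ⟧ M.*ₗ m) M.*ₗ-congˡ (M.*ₗ-distribˡ ι.⟦ z ⟧)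
      (λ r m → M.≈ᴹ-trans (M.≈ᴹ-sym (M.*ₗ-assoc _ r m))
        (M.≈ᴹ-trans (M.*ₗ-congʳ (A.sym (A.ι-central z r))) (M.*ₗ-assoc r _ m))))
    (λ e m → M.*ₗ-congʳ (ι.⟦⟧-cong e))
    (λ z w m → M.≈ᴹ-trans (M.*ₗ-congʳ (ι.*-homo z w)) (M.*ₗ-assoc _ _ m))
    (λ m → M.≈ᴹ-trans (M.*ₗ-congʳ ι.1#-homo) (M.*ₗ-identityˡ m))
    (λ m z w → M.≈ᴹ-trans (M.*ₗ-congʳ (ι.+-homo z w)) (M.*ₗ-distribʳ m _ _))
    where
    module A = Algebra A
    module ι = RingHom A.ι
    module M = LeftModule M

  module AlgTensor (A B : Algebra) where
    private
      module A = Algebra A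
      module B = Algebra B
      module ιA = RingHom A.ι
      module ιB = RingHom B.ι

    module E = External A.ring B.ring ιA.⟦_⟧ ιB.⟦_⟧ A.ι-central B.ι-central
    private
      ringᴱ = E.ring
      module T = E.⊠ (regular A.ring) (regular B.ring)
      open T using (_⊗_; relation; ⊗-cong; ⊗-distribˡ; ⊗-distribʳ; balanced)
      module AB = Ring ringᴱ

      left : RingHom A.ring ringᴱ
      left = mkRingHom A.ring ringᴱ (_⊗ B.1#) (λ e → relation (⊗-cong e B.refl)) (λ x y → relation (⊗-distribʳ _ x y))
        (λ x y → relation (⊗-cong A.refl (B.sym (B.*-identityˡ _)))) AB.refl

      right : RingHom B.ring ringᴱ
      right = mkRingHom B.ring ringᴱ (A.1# ⊗_) (λ e → relation (⊗-cong A.refl e)) (λ x y → relation (⊗-distribˡ _ x y))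
        (λ x y → relation (⊗-cong (A.sym (A.*-identityˡ _)) B.refl)) AB.refl

      module left = RingHom left
      module right = RingHom right

      left*right : ∀ a b → left.⟦ a ⟧ AB.* right.⟦ b ⟧ AB.≈ a ⊗ b
      left*right a b = relation (⊗-cong (A.*-identityʳ a) (B.*-identityˡ b))

      right*left : ∀ a b → right.⟦ b ⟧ AB.* left.⟦ a ⟧ AB.≈ a ⊗ b
      right*left a b = relation (⊗-cong (A.*-identityˡ a) (B.*-identityʳ b))

    algebra : Algebra
    algebra = record
      { ring = ringᴱ
      ; ι = left ∘ᴿ A.ι
      ; ι-central = λ z → additive-unique T.group (AB._* left.⟦ ιA.⟦ z ⟧ ⟧) (left.⟦ ιA.⟦ z ⟧ ⟧ AB.*_)
          (eval-isAdditive T.group _) (eval-isAdditive T.group _)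
          (λ ab → relation (⊗-cong (A.ι-central z _) (B.trans (B.*-identityʳ _) (B.sym (B.*-identityˡ _)))))
      }

    module _ (M : AlgMod A) (N : AlgMod B) where
      private
        module M = LeftModule M
        module N = LeftModule N
        module MN = E.⊠ M N

      infixl 7 _⊠_
      _⊠_ : AlgMod algebra
      _⊠_ = E._⊠ᴹ_ M N

      ⊠-fg : IsFinitelyGenerated M → IsFinitelyGenerated N → IsFinitelyGenerated _⊠_
      ⊠-fg (finitelyGenerated p g g-spans) (finitelyGenerated q h h-spans) = finitelyGenerated (p ℕ.* q) gh spans
        where
        gh : Fin (p ℕ.* q) → Expr (M.Carrierᴹ × N.Carrierᴹ)
        gh x = g (proj₁ (remQuot q x)) MN.⊗ h (proj₂ (remQuot {p} q x))
        open Span _⊠_ gh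
        generator : ∀ i j → InSpan (g i MN.⊗ h j)
        generator i j = subst (λ x → InSpan (g (proj₁ x) MN.⊗ h (proj₂ x))) (remQuot-combine {p} {q} i j)
          (generator∈span _⊠_ gh (combine i j))
        pure-h : ∀ m j → InSpan (m MN.⊗ h j)
        pure-h m j = let (c , m≈) = g-spans m in
          resp (MN.sym (MN.trans (MN.relation (MN.⊗-cong m≈ N.≈ᴹ-refl))
            (sum-homo M.+ᴹ-abelianGroup MN.group (MN._⊗ h j) (λ e → MN.relation (MN.⊗-cong e N.≈ᴹ-refl))
              (λ x y → MN.relation (MN.⊗-distribʳ _ x y)) (λ i → c i M.*ₗ g i))))
          (sum-closed _ (λ i → resp (MN.relation (MN.⊗-cong M.≈ᴹ-refl (N.*ₗ-identityˡ _)))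
            (*-closed (c i ⊗ B.1#) (generator i j))))
        pure : ∀ m n → InSpan (m MN.⊗ n)
        pure m n = let (c , n≈) = h-spans n in
          resp (MN.sym (MN.trans (MN.relation (MN.⊗-cong M.≈ᴹ-refl n≈))
            (sum-homo N.+ᴹ-abelianGroup MN.group (m MN.⊗_) (λ e → MN.relation (MN.⊗-cong M.≈ᴹ-refl e))
              (λ x y → MN.relation (MN.⊗-distribˡ _ x y)) (λ j → c j N.*ₗ h j))))
          (sum-closed _ (λ j → resp (MN.relation (MN.⊗-cong (M.*ₗ-identityˡ _) N.≈ᴹ-refl))
            (*-closed (A.1# ⊗ c j) (pure-h m j))))
        spans : ∀ t → InSpan t
        spans [ m , n ] = pure m n
        spans 𝟎         = 0-closed
        spans (s ⊕ t)   = +-closed (spans s) (spans t)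
        spans (⊖ s)     = neg-closed (spans s)

    private
      -- The B-linear maps Q → X, as an A-module, for a module X over A ⊗ B.
      module Curry (Q : AlgMod B) (X : AlgMod algebra) where
        private module X = LeftModule X
        X′ = restrict right X
        curried : AlgMod A
        curried = homModule {B = A.ring} Q X′
          (λ a → mkHom X′ X′ (λ x → left.⟦ a ⟧ X.*ₗ x) X.*ₗ-congˡ (X.*ₗ-distribˡ _)
            (λ b x → X.≈ᴹ-trans (X.≈ᴹ-sym (X.*ₗ-assoc _ _ x))
              (X.≈ᴹ-trans (X.*ₗ-congʳ (AB.trans (left*right a b) (AB.sym (right*left a b)))) (X.*ₗ-assoc _ _ x))))
          (λ e x → X.*ₗ-congʳ (left.⟦⟧-cong e))
          (λ a a′ x → X.≈ᴹ-trans (X.*ₗ-congʳ (left.*-homo a a′)) (X.*ₗ-assoc _ _ x))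
          (λ x → X.*ₗ-identityˡ x)
          (λ x a a′ → X.≈ᴹ-trans (X.*ₗ-congʳ (left.+-homo a a′)) (X.*ₗ-distribʳ x _ _))

    ⊠-projective : (P : AlgMod A) (Q : AlgMod B) → IsProjective P → IsProjective Q → IsProjective (P ⊠ Q)
    lift (⊠-projective P Q P-proj Q-proj) M N g g-surj f = h , additive-unique N.+ᴹ-abelianGroup _ _
        (record { 𝟎-homo = Hom.0ᴹ-homo g ; ⊕-homo = λ _ _ → Hom.+ᴹ-homo g _ _ ; ⊖-homo = λ _ → Hom.-ᴹ-homo g _ })
        (record { 𝟎-homo = Hom.0ᴹ-homo f ; ⊕-homo = Hom.+ᴹ-homo f ; ⊖-homo = Hom.-ᴹ-homo f })
        (λ pq → proj₂ lifted (proj₁ pq) (proj₂ pq))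
      where
      module P = LeftModule P
      module Q = LeftModule Q
      module M = LeftModule M
      module N = LeftModule N
      module PQ = E.⊠ P Q
      module CM = Curry Q M
      module CN = Curry Q N
      G : Hom CM.curried CN.curried
      G = mkHom CM.curried CN.curried
        (λ u → mkHom Q CN.X′ (λ q → Hom.⟦ g ⟧ (Hom.⟦ u ⟧ q)) (λ e → Hom.⟦⟧-cong g (Hom.⟦⟧-cong u e))
          (λ x y → N.≈ᴹ-trans (Hom.⟦⟧-cong g (Hom.+ᴹ-homo u x y)) (Hom.+ᴹ-homo g _ _))
          (λ r x → N.≈ᴹ-trans (Hom.⟦⟧-cong g (Hom.*ₗ-homo u r x)) (Hom.*ₗ-homo g _ _)))
        (λ e q → Hom.⟦⟧-cong g (e q)) (λ _ _ _ → Hom.+ᴹ-homo g _ _) (λ _ _ _ → Hom.*ₗ-homo g _ _)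
      G-surj : IsSurjective G
      G-surj v = let (u , gu≈v) = lift Q-proj CM.X′ CN.X′ (restrictHom right {M} {N} g) g-surj v in
        u , λ e q → N.≈ᴹ-trans (Hom.⟦⟧-cong g (e q)) (gu≈v q)
      F : Hom P CN.curried
      F = mkHom P CN.curried
        (λ p → mkHom Q CN.X′ (λ q → Hom.⟦ f ⟧ (p PQ.⊗ q)) (λ e → Hom.⟦⟧-cong f (PQ.relation (PQ.⊗-cong P.≈ᴹ-refl e)))
          (λ x y → N.≈ᴹ-trans (Hom.⟦⟧-cong f (PQ.relation (PQ.⊗-distribˡ _ x y))) (Hom.+ᴹ-homo f _ _))
          (λ b q → N.≈ᴹ-trans (Hom.⟦⟧-cong f (PQ.relation (PQ.⊗-cong (P.≈ᴹ-sym (P.*ₗ-identityˡ p)) Q.≈ᴹ-refl))) (Hom.*ₗ-homo f _ _)))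
        (λ e q → Hom.⟦⟧-cong f (PQ.relation (PQ.⊗-cong e Q.≈ᴹ-refl)))
        (λ x y q → N.≈ᴹ-trans (Hom.⟦⟧-cong f (PQ.relation (PQ.⊗-distribʳ _ x y))) (Hom.+ᴹ-homo f _ _))
        (λ a p q → N.≈ᴹ-trans (Hom.⟦⟧-cong f (PQ.relation (PQ.⊗-cong P.≈ᴹ-refl (Q.≈ᴹ-sym (Q.*ₗ-identityˡ q))))) (Hom.*ₗ-homo f _ _))
      lifted = lift P-proj CM.curried CN.curried G G-surj F
      module H = Hom (proj₁ lifted)
      value : P.Carrierᴹ × Q.Carrierᴹ → M.Carrierᴹ
      value pq = Hom.⟦ H.⟦ proj₁ pq ⟧ ⟧ (proj₂ pq)
      scalars : ∀ z m → left.⟦ ιA.⟦ z ⟧ ⟧ M.*ₗ m M.≈ᴹ right.⟦ ιB.⟦ z ⟧ ⟧ M.*ₗ m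
      scalars z m = M.*ₗ-congʳ (AB.trans (relation (⊗-cong (A.sym (A.*-identityʳ _)) B.refl))
        (AB.trans (relation (balanced _ z _)) (relation (⊗-cong A.refl (B.*-identityʳ _)))))
      h : Hom (P ⊠ Q) M
      h = mkHom (P ⊠ Q) M (eval M.+ᴹ-abelianGroup value)
        (PQ.IsBalanced.induced-cong {G = M.+ᴹ-abelianGroup} {f = value} (record
          { f-cong = λ {m} {m′} {n} {n′} e e′ → M.≈ᴹ-trans (H.⟦⟧-cong e n) (Hom.⟦⟧-cong H.⟦ m′ ⟧ e′)
          ; f-distribˡ = λ p → Hom.+ᴹ-homo H.⟦ p ⟧
          ; f-distribʳ = λ q p p′ → H.+ᴹ-homo p p′ q
          ; f-balanced = λ p z q → M.≈ᴹ-trans (H.*ₗ-homo _ p q) (M.≈ᴹ-trans (scalars z _) (M.≈ᴹ-sym (Hom.*ₗ-homo H.⟦ p ⟧ _ q)))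
          }))
        (λ _ _ → M.≈ᴹ-refl)
        (λ s t → additive-unique M.+ᴹ-abelianGroup
          (λ s → eval M.+ᴹ-abelianGroup value (LeftModule._*ₗ_ (P ⊠ Q) s t)) (λ s → s M.*ₗ eval M.+ᴹ-abelianGroup value t)
          (record { 𝟎-homo = M.≈ᴹ-refl ; ⊕-homo = λ _ _ → M.≈ᴹ-refl ; ⊖-homo = λ _ → M.≈ᴹ-refl })
          (record { 𝟎-homo = M.*ₗ-zeroˡ _ ; ⊕-homo = λ _ _ → M.*ₗ-distribʳ _ _ _
                  ; ⊖-homo = λ _ → IsGroupHomomorphism.⁻¹-homo
                      (mkGroupHom AB.+-abelianGroup M.+ᴹ-abelianGroup (λ s → s M.*ₗ _) M.*ₗ-congʳ (M.*ₗ-distribʳ _)) _ })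
          (λ { (a , b) → additive-unique M.+ᴹ-abelianGroup
            (λ t → eval M.+ᴹ-abelianGroup value (LeftModule._*ₗ_ (P ⊠ Q) (a ⊗ b) t)) (λ t → (a ⊗ b) M.*ₗ eval M.+ᴹ-abelianGroup value t)
            (record { 𝟎-homo = M.≈ᴹ-refl ; ⊕-homo = λ _ _ → M.≈ᴹ-refl ; ⊖-homo = λ _ → M.≈ᴹ-refl })
            (record { 𝟎-homo = M.*ₗ-zeroʳ _ ; ⊕-homo = λ _ _ → M.*ₗ-distribˡ _ _ _
                    ; ⊖-homo = λ _ → IsGroupHomomorphism.⁻¹-homo
                        (mkGroupHom M.+ᴹ-abelianGroup M.+ᴹ-abelianGroup ((a ⊗ b) M.*ₗ_) M.*ₗ-congˡ (M.*ₗ-distribˡ _)) _ })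
            (λ { (p , q) → M.≈ᴹ-trans (H.*ₗ-homo a p (b Q.*ₗ q)) (M.≈ᴹ-trans (M.*ₗ-congˡ (Hom.*ₗ-homo H.⟦ p ⟧ b q))
              (M.≈ᴹ-trans (M.≈ᴹ-sym (M.*ₗ-assoc _ _ _)) (M.*ₗ-congʳ (left*right a b)))) }) t }) s)

  infixl 7 _⊗ᴬ_
  _⊗ᴬ_ : Algebra → Algebra → Algebra
  A ⊗ᴬ B = AlgTensor.algebra A B

  module _ (A B : Algebra) where
    -- M ⊠ N over A ⊗ B.
    outer : AlgMod A → AlgMod B → AlgMod (A ⊗ᴬ B)
    outer = AlgTensor._⊠_ A B

    outer-fg : ∀ M N → IsFinitelyGenerated M → IsFinitelyGenerated N → IsFinitelyGenerated (outer M N)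
    outer-fg = AlgTensor.⊠-fg A B

    outer-projective : ∀ P Q → IsProjective P → IsProjective Q → IsProjective (outer P Q)
    outer-projective = AlgTensor.⊠-projective A B

-- Generated by the modules in the class 𝒞, with [M] = [L] + [N] for every short
-- exact sequence 0 → L → M → N → 0 of modules in 𝒞.
module Grothendieck {p : Level} (R : Ring 0ℓ 0ℓ) (𝒞 : Mod R → Set p) where

  Object : Set (lsuc 0ℓ ⊔ p)
  Object = Σ (Mod R) 𝒞

  data _∼_ : Expr Object → Expr Object → Set (lsuc 0ℓ ⊔ p) where
    exact : ∀ L M N → ShortExact (proj₁ L) (proj₁ M) (proj₁ N) → [ M ] ∼ ([ L ] ⊕ [ N ])

  open Presentation _∼_ public

module _ {a ℓ : Level} (H : ℕ → AbelianGroup a ℓ) where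
  private module H n = AbelianGroup (H n)

  -- [ n , x ] is the homogeneous element x of degree n.
  module DirectSum where

    data _∼_ : Expr (Σ ℕ H.Carrier) → Expr (Σ ℕ H.Carrier) → Set (a ⊔ ℓ) where
      homogeneous-cong : ∀ {n} {x y : H.Carrier n} → H._≈_ n x y → [ n , x ] ∼ [ n , y ]
      homogeneous-+    : ∀ {n} (x y : H.Carrier n) → [ n , H._∙_ n x y ] ∼ ([ n , x ] ⊕ [ n , y ])

    open Presentation _∼_ public

-- Bilinear maps are automatically balanced over ℤ, so tensor products over ℤ are
-- balanced over the empty set of scalars.
infixr 7 _⊗ℤ_
_⊗ℤ_ : {a ℓa b ℓb : Level} → AbelianGroup a ℓa → AbelianGroup b ℓb → AbelianGroup (a ⊔ b) (a ⊔ ℓa ⊔ b ⊔ ℓb)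
M ⊗ℤ N = Tensor.group M N {R = ⊥} (λ _ ()) (λ ())

tensorSquare : {a ℓ : Level} → Ring a ℓ → Ring a (a ⊔ ℓ)
tensorSquare H = External.ring H H {R = ⊥} (λ ()) (λ ()) (λ ()) (λ ())

module _ {a ℓ : Level} (G : AbelianGroup a ℓ) where
  open AbelianGroup G
  open MonoidMult monoid using () renaming (_×_ to _·ℕ_)

  infixr 8 _·ℤ_
  _·ℤ_ : ℤ → Carrier → Carrier
  (+ n)    ·ℤ x = n ·ℕ x
  -[1+ n ] ·ℤ x = (suc n ·ℕ x) ⁻¹

record GradedConnectedHopfAlgebra {a ℓ : Level} (H : ℕ → AbelianGroup a ℓ) : Set (a ⊔ ℓ) where
  private
    module H n = AbelianGroup (H n)
    total = DirectSum.group H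
    module T = AbelianGroup total
  open T using (_≈_) renaming (_∙_ to _+ᵀ_; _⁻¹ to -ᵀ_; ε to 0ᵀ; Carrier to Total) public
  infixl 7 _∙_
  field
    _∙_    : Total → Total → Total
    1#     : Total
    isRing : IsRing _≈_ _+ᵀ_ _∙_ -ᵀ_ 0ᵀ 1#

  ring : Ring a (a ⊔ ℓ)
  ring = record { isRing = isRing }

  square : AbelianGroup a (a ⊔ ℓ)
  square = Ring.+-abelianGroup (tensorSquare ring)
  cube : AbelianGroup a (a ⊔ ℓ)
  cube = total ⊗ℤ square

  field
    Δ     : Total → Expr (Total × Total)
    Δ-hom : IsRingHomomorphism (Ring.rawRing ring) (Ring.rawRing (tensorSquare ring)) Δ
    ε     : Total → ℤ
    ε-hom : IsRingHomomorphism (Ring.rawRing ring) (Ring.rawRing ℤ.+-*-ring) ε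

    coassociative : ∀ z → AbelianGroup._≈_ cube
      (eval cube (λ (x , y) → eval cube (λ (x₁ , x₂) → [ x₁ , [ x₂ , y ] ]) (Δ x)) (Δ z))
      (eval cube (λ (x , y) → [ x , Δ y ]) (Δ z))
    counitˡ : ∀ z → eval total (λ (x , y) → _·ℤ_ total (ε x) y) (Δ z) ≈ z
    counitʳ : ∀ z → eval total (λ (x , y) → _·ℤ_ total (ε y) x) (Δ z) ≈ z

    S         : Total → Total
    S-hom     : IsGroupHomomorphism T.rawGroup T.rawGroup S
    antipodeˡ : ∀ z → eval total (λ (x , y) → S x ∙ y) (Δ z) ≈ _·ℤ_ total (ε z) 1#
    antipodeʳ : ∀ z → eval total (λ (x , y) → x ∙ S y) (Δ z) ≈ _·ℤ_ total (ε z) 1#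

  -- The map H k ⊗ H l → T ⊗ T.
  include : ∀ k l → Expr (H.Carrier k × H.Carrier l) → Expr (Total × Total)
  include k l = eval square (λ (x , y) → [ [ k , x ] , [ l , y ] ])

  -- An element of T ⊗ T given by its components of bidegrees (k , l) with k + l = n.
  fromComponents : ∀ n → ((i : Fin (suc n)) → Expr (H.Carrier (toℕ i) × H.Carrier (n ∸ toℕ i))) → Expr (Total × Total)
  fromComponents n t = Sum.sum (AbelianGroup.commutativeMonoid square) (λ i → include (toℕ i) (n ∸ toℕ i) (t i))

  field
    ∙-graded  : ∀ m n x y → ∃ λ z → [ m , x ] ∙ [ n , y ] ≈ [ m + n , z ]
    1-graded  : ∃ λ e → 1# ≈ [ 0 , e ]
    Δ-graded  : ∀ n x → ∃ λ t → AbelianGroup._≈_ square (Δ [ n , x ]) (fromComponents n t)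
    ε-graded  : ∀ n x → ε [ suc n , x ] ≡ 0ℤ
    S-graded  : ∀ n x → ∃ λ y → S [ n , x ] ≈ [ n , y ]
    -- Since ε 1# = 1, this says that the unit ℤ → H 0 is an isomorphism.
    connected : ∀ x → [ 0 , x ] ≈ _·ℤ_ total (ε [ 0 , x ]) 1#

module Towers (k : CommutativeRing 0ℓ 0ℓ) where
  private module k = CommutativeRing k
  open Over k

  -- The element 1 of A 0 is a unit for the external multiplication: ρ(1 ⊗ -) is injective,
  -- and it is idempotent because ρ is associative and ρ(1 ⊗ 1) = 1; likewise on the right.
  -- Associativity is stated on pure tensors, which determine additive maps.
  record Tower : Set₁ where
    field
      A : ℕ → Algebra
    module A n = Algebra (A n)
    field
      finiteDimensional : ∀ n → Σ ℕ (HasDimension (underlying (A n) (regular (Algebra.ring (A n)))))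
      A₀≅k              : Σ (AlgHom (A 0) base) λ f → Bijective (A._≈_ 0) k._≈_ (AlgHom.⟦_⟧ f)
      ρ                 : ∀ m n → AlgHom (A m ⊗ᴬ A n) (A (m + n))

    module ρ m n = AlgHom (ρ m n)

    field
      ρ-injective : ∀ m n → Injective (Algebra._≈_ (A m ⊗ᴬ A n)) (A._≈_ (m + n)) (ρ.⟦_⟧ m n)
      ρ-assoc     : ∀ m n p a b c →
        A._≈_ (m + (n + p))
          (subst A.Carrier (ℕ.+-assoc m n p) (ρ.⟦_⟧ (m + n) p [ ρ.⟦_⟧ m n [ a , b ] , c ]))
          (ρ.⟦_⟧ m (n + p) [ a , ρ.⟦_⟧ n p [ b , c ] ])
      projectiveˡ : ∀ m n → IsProjective (restrict (AlgHom.ringHom (ρ m n)) (regular (Algebra.ring (A (m + n)))))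
      -- A right module is a left module over the opposite ring.
      projectiveʳ : ∀ m n → IsProjective (restrict (opHom (AlgHom.ringHom (ρ m n))) (regular (Algebra.ring (A (m + n)) ᵒᵖ)))

    dim : ℕ → ℕ
    dim n = proj₁ (finiteDimensional n)

    ρ-at : ∀ k l {n} → k + l ≡ n → RingHom (Algebra.ring (A k ⊗ᴬ A l)) (Algebra.ring (A n))
    ρ-at k l refl = AlgHom.ringHom (ρ k l)

    ρ-at-projective : ∀ k l {n} (eq : k + l ≡ n) → IsProjective (restrict (ρ-at k l eq) (regular (Algebra.ring (A n))))
    ρ-at-projective k l refl = projectiveˡ k l

    ρ-at-fg : ∀ k l {n} (eq : k + l ≡ n) → IsFinitelyGenerated (restrict (ρ-at k l eq) (regular (Algebra.ring (A n))))
    ρ-at-fg k l refl = let (d , b , spans , _) = finiteDimensional (k + l) in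
      finitelyGenerated d b λ x → let (c , x≈) = spans x in
        (λ i → RingHom.⟦ ι ⟧ (c i)) ,
        A.trans (k + l) x≈ (sum-cong-≋ (λ i → A.*-congʳ (k + l) (A.sym (k + l) (ρ.ι-homo k l (c i)))))
      where
      ι = Algebra.ι (A k ⊗ᴬ A l)
      open Sum (AbelianGroup.commutativeMonoid (A.+-abelianGroup (k + l))) using (sum-cong-≋)

  module _ (T : Tower) where
    open Tower T

    -- A class of modules stable under the operations that define the structure on
    -- the Grothendieck groups.
    record ModuleClass (p : Level) : Set (lsuc (lsuc 0ℓ ⊔ p)) where
      field
        𝒞   : {R : Ring 0ℓ 0ℓ} → Mod R → Set p
        ⊠-𝒞 : ∀ m n (M : AlgMod (A m)) (N : AlgMod (A n)) → 𝒞 M → 𝒞 N → 𝒞 (outer (A m) (A n) M N)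
        ind-𝒞 : ∀ m n (M : AlgMod (A m ⊗ᴬ A n)) → 𝒞 M → 𝒞 (Induction.ind (AlgHom.ringHom (ρ m n)) M)
        res-𝒞 : ∀ k l {n} (eq : k + l ≡ n) (N : AlgMod (A n)) → 𝒞 N → 𝒞 (restrict (ρ-at k l eq) N)

      module K (B : Algebra) = Grothendieck (Algebra.ring B) 𝒞

      infixl 7 _⊠ᶜ_
      _⊠ᶜ_ : ∀ {m n} → K.Object (A m) → K.Object (A n) → K.Object (A m ⊗ᴬ A n)
      _⊠ᶜ_ {m} {n} (M , p) (N , q) = outer (A m) (A n) M N , ⊠-𝒞 m n M N p q

      Ind : ∀ {m n} → K.Object (A m ⊗ᴬ A n) → K.Object (A (m + n))
      Ind {m} {n} (M , p) = Induction.ind (AlgHom.ringHom (ρ m n)) M , ind-𝒞 m n M p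

      Res : ∀ k l {n} → k + l ≡ n → K.Object (A n) → K.Object (A k ⊗ᴬ A l)
      Res k l eq (N , p) = restrict (ρ-at k l eq) N , res-𝒞 k l eq N p

    fg : ModuleClass 0ℓ
    fg = record
      { 𝒞 = IsFinitelyGenerated
      ; ⊠-𝒞 = λ m n → outer-fg (A m) (A n)
      ; ind-𝒞 = λ m n → ind-fg (AlgHom.ringHom (ρ m n))
      ; res-𝒞 = λ k l eq → restrict-fg (ρ-at k l eq) (ρ-at-fg k l eq)
      }

    fgProjective : ModuleClass (lsuc 0ℓ)
    fgProjective = record
      { 𝒞 = λ M → IsFinitelyGenerated M × IsProjective M
      ; ⊠-𝒞 = λ m n M N (p , p′) (q , q′) → outer-fg (A m) (A n) M N p q , outer-projective (A m) (A n) M N p′ q′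
      ; ind-𝒞 = λ m n M (p , p′) → ind-fg (AlgHom.ringHom (ρ m n)) M p , ind-projective (AlgHom.ringHom (ρ m n)) M p′
      ; res-𝒞 = λ k l eq N (p , p′) → restrict-fg (ρ-at k l eq) (ρ-at-fg k l eq) N p
                                    , restrict-projective (ρ-at k l eq) (ρ-at-projective k l eq) N p′
      }

    module _ {p : Level} (class : ModuleClass p) where
      open ModuleClass class

      summand : ℕ → AbelianGroup (lsuc 0ℓ ⊔ p) (lsuc 0ℓ ⊔ p)
      summand n = K.group (A n)

      -- A graded connected Hopf algebra structure on the direct sum of the Grothendieck groups
      -- with [M][N] = [Ind (M ⊠ N)] and Δ[N] = Σ_{k+l=n} [Res N].
      record GrothendieckHopf : Set (lsuc 0ℓ ⊔ p) where
        field
          hopf : GradedConnectedHopfAlgebra summand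
        open GradedConnectedHopfAlgebra hopf public

        field
          -- The identification of the Grothendieck group of A k ⊗ A l with the tensor product of
          -- those of A k and A l. Over an algebraically closed field the simple modules and the
          -- indecomposable projectives of A k ⊗ A l are the M ⊠ N, so it exists and is unique.
          view      : ∀ k l → Expr (K.Object (A k ⊗ᴬ A l)) → Expr (Expr (K.Object (A k)) × Expr (K.Object (A l)))
          view-iso  : ∀ k l → IsGroupIsomorphism (AbelianGroup.rawGroup (K.group (A k ⊗ᴬ A l)))
                                                 (AbelianGroup.rawGroup (summand k ⊗ℤ summand l)) (view k l)
          view-⊠    : ∀ k l (M : K.Object (A k)) (N : K.Object (A l)) →
                      AbelianGroup._≈_ (summand k ⊗ℤ summand l) (view k l [ M ⊠ᶜ N ]) [ [ M ] , [ N ] ]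

          ∙-class   : ∀ m n (M : K.Object (A m)) (N : K.Object (A n)) →
                      [ m , [ M ] ] ∙ [ n , [ N ] ] ≈ [ m + n , [ Ind (M ⊠ᶜ N) ] ]
          Δ-class   : ∀ n (N : K.Object (A n)) →
                      AbelianGroup._≈_ square (Δ [ n , [ N ] ]) (fromComponents n λ i →
                        let k = toℕ i ; l = n ∸ k in view k l [ Res k l (ℕ.m+[n∸m]≡n (toℕ≤pred[n] i)) N ])

    -- K(A) and G(A) are graded connected Hopf algebras, graded dual to each other. All of the
    -- structure is unique: ∙ and Δ are given on generators by ∙-class and Δ-class and determine
    -- the unit, counit and antipode, and ⟨_,_⟩ is given by ⟨⟩-class and ⟨⟩-degree.
    record FormDualHopfAlgebras : Set (lsuc 0ℓ) where
      field
        KA : GrothendieckHopf fgProjective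
        GA : GrothendieckHopf fg
      module KA = GrothendieckHopf KA
      module GA = GrothendieckHopf GA
      module Kₙ n = AbelianGroup (summand fgProjective n)
      module Gₙ n = AbelianGroup (summand fg n)

      field
        ⟨_,_⟩    : KA.Total → GA.Total → ℤ
        ⟨⟩-cong  : ∀ {a b x y} → a KA.≈ b → x GA.≈ y → ⟨ a , x ⟩ ≡ ⟨ b , y ⟩
        ⟨⟩-addˡ  : ∀ a b x → ⟨ a KA.+ᵀ b , x ⟩ ≡ ⟨ a , x ⟩ ℤ.+ ⟨ b , x ⟩
        ⟨⟩-addʳ  : ∀ a x y → ⟨ a , x GA.+ᵀ y ⟩ ≡ ⟨ a , x ⟩ ℤ.+ ⟨ a , y ⟩

        -- Classically every Hom_A(P , M) here has a dimension; constructively a finitely generated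
        -- vector space need not have a basis, so the dimension is described by a relation.
        ⟨⟩-class : ∀ n (P : ModuleClass.K.Object fgProjective (A n)) (M : ModuleClass.K.Object fg (A n)) d →
                   HasDimension (homSpace (A n) (proj₁ P) (proj₁ M)) d →
                   ⟨ [ n , [ P ] ] , [ n , [ M ] ] ⟩ ≡ + d
        ⟨⟩-degree : ∀ m n a x → m ≢ n → ⟨ [ m , a ] , [ n , x ] ⟩ ≡ 0ℤ

        ∙-Δ-adjoint : ∀ a b x → ⟨ a KA.∙ b , x ⟩ ≡ eval ℤ.+-0-abelianGroup (λ (y , z) → ⟨ a , y ⟩ ℤ.* ⟨ b , z ⟩) (GA.Δ x)
        Δ-∙-adjoint : ∀ a x y → ⟨ a , x GA.∙ y ⟩ ≡ eval ℤ.+-0-abelianGroup (λ (b , c) → ⟨ b , x ⟩ ℤ.* ⟨ c , y ⟩) (KA.Δ a)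
        1-ε-adjoint : ∀ x → ⟨ KA.1# , x ⟩ ≡ GA.ε x
        ε-1-adjoint : ∀ a → ⟨ a , GA.1# ⟩ ≡ KA.ε a

        -- In each degree the pairing identifies either group with the ℤ-dual of the other.
        perfectˡ : ∀ n φ → IsGroupHomomorphism (Gₙ.rawGroup n) (AbelianGroup.rawGroup ℤ.+-0-abelianGroup) φ →
                   Σ (Kₙ.Carrier n) λ a → (∀ x → ⟨ [ n , a ] , [ n , x ] ⟩ ≡ φ x)
                     × (∀ b → (∀ x → ⟨ [ n , b ] , [ n , x ] ⟩ ≡ φ x) → Kₙ._≈_ n b a)
        perfectʳ : ∀ n φ → IsGroupHomomorphism (Kₙ.rawGroup n) (AbelianGroup.rawGroup ℤ.+-0-abelianGroup) φ →
                   Σ (Gₙ.Carrier n) λ x → (∀ a → ⟨ [ n , a ] , [ n , x ] ⟩ ≡ φ a)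
                     × (∀ y → (∀ a → ⟨ [ n , a ] , [ n , y ] ⟩ ≡ φ a) → Gₙ._≈_ n y x)

{-# OPTIONS --safe #-}

-- Let p and q be the classes of the regular module A 1 in K(A) and G(A). Elements of
-- degree 1 are primitive, so multiplication by p and the adjoint of multiplication by q
-- satisfy the Heisenberg relation, whence ⟨ pⁿ⁺¹ , q y ⟩ = (n + 1) ⟨ p , q ⟩ ⟨ pⁿ , y ⟩.
-- Inducing a tensor product of regular modules gives a regular module, so pⁿ and qⁿ are
-- the classes of A n for n ≥ 1, and ⟨ [A n] , [A n] ⟩ = dim End (A n) = dim (A n). Taking
-- y = qⁿ yields dim (A (n + 1)) = (n + 1) · dim (A 1) · dim (A n).
module Submission where

open import Defs
open import Algebra.Bundles using (AbelianGroup; CommutativeRing; Ring)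
import Algebra.Module.Construct.Zero as Zero
open import Algebra.Module.Bundles using (LeftModule)
import Algebra.Properties.CommutativeMonoid.Sum as Sum
open import Algebra.Morphism.Structures using (IsGroupHomomorphism; IsRingHomomorphism)
open import Data.Fin.Base using (Fin; zero; suc)
open import Data.Integer.Base as ℤ using (ℤ; +_; -[1+_]; 0ℤ; 1ℤ)
import Data.Integer.Properties as ℤ
open import Data.Integer.Tactic.RingSolver using (solve-∀)
open import Data.Nat.Base using (ℕ; zero; suc; _+_; _*_; _^_; _!)
import Data.Nat.Properties as ℕ
import Data.Nat.Tactic.RingSolver as ℕ-Solver
open import Data.Product.Base using (Σ; _×_; _,_; proj₁; proj₂)
open import Data.Unit.Polymorphic.Base using (tt)
open import Function.Base using (id)
open import Function.Definitions using (Bijective)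
open import Level using (Level; 0ℓ; _⊔_)
open import Relation.Binary.PropositionalEquality.Core using (_≡_; refl; sym; trans; cong; cong₂)
open import Relation.Binary.PropositionalEquality.Properties using (module ≡-Reasoning)

open Evaluation

-- Integer-valued additive maps on formal sums.

private
  variable
    a ℓ x y : Level
    X : Set x
    Y : Set y

evalℤ : (X → ℤ) → Expr X → ℤ
evalℤ = eval ℤ.+-0-abelianGroup

evalℤ-cong : {f g : X → ℤ} → (∀ x → f x ≡ g x) → ∀ t → evalℤ f t ≡ evalℤ g t
evalℤ-cong = additive-unique ℤ.+-0-abelianGroup _ _ (eval-isAdditive _ _) (eval-isAdditive _ _)

evalℤ-0 : (t : Expr X) → evalℤ (λ _ → 0ℤ) t ≡ 0ℤ
evalℤ-0 = additive-unique ℤ.+-0-abelianGroup _ _ (eval-isAdditive _ _) (ε-isAdditive _) (λ _ → refl)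

evalℤ-+ : (f g : X → ℤ) → ∀ t → evalℤ (λ x → f x ℤ.+ g x) t ≡ evalℤ f t ℤ.+ evalℤ g t
evalℤ-+ f g = additive-unique ℤ.+-0-abelianGroup _ _ (eval-isAdditive _ _)
  (∙-isAdditive _ (eval-isAdditive _ f) (eval-isAdditive _ g)) (λ _ → refl)

evalℤ-neg : (f : X → ℤ) → ∀ t → evalℤ (λ x → ℤ.- f x) t ≡ ℤ.- evalℤ f t
evalℤ-neg f = additive-unique ℤ.+-0-abelianGroup _ _ (eval-isAdditive _ _)
  (⁻¹-isAdditive _ (eval-isAdditive _ f)) (λ _ → refl)

-- Both sides are additive in `s`, so comparing them on a generator is enough. This Fubini rule
-- later exchanges the sums over two coproducts.
evalℤ-swap : (f : X → Y → ℤ) → ∀ s t → evalℤ (λ x → evalℤ (f x) t) s ≡ evalℤ (λ y → evalℤ (λ x → f x y) s) t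
evalℤ-swap f s t = additive-unique ℤ.+-0-abelianGroup _ (λ s → evalℤ (λ y → evalℤ (λ x → f x y) s) t) (eval-isAdditive _ _)
  (record { 𝟎-homo = evalℤ-0 t ; ⊕-homo = λ _ _ → evalℤ-+ _ _ t ; ⊖-homo = λ _ → evalℤ-neg _ t })
  (λ _ → refl) s

-- A presented group has the constructors of `Expr` as its operations, whatever the relation, so
-- composing the two additive extensions is additive by `refl`.
evalℤ-eval : {r : Level} {_∼_ : Expr Y → Expr Y → Set r} (f : Y → ℤ) (h : X → Expr Y) → ∀ t →
             evalℤ f (eval (Presentation.group _∼_) h t) ≡ evalℤ (λ x → evalℤ f (h x)) t
evalℤ-eval {_∼_ = _∼_} f h = additive-unique ℤ.+-0-abelianGroup (λ t → evalℤ f (eval (Presentation.group _∼_) h t)) _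
  (record { 𝟎-homo = refl ; ⊕-homo = λ _ _ → refl ; ⊖-homo = λ _ → refl })
  (eval-isAdditive _ _) (λ _ → refl)

module _ (G : AbelianGroup a ℓ) where
  private module G = AbelianGroup G

  record Functional : Set (a ⊔ ℓ) where
    field
      ⟦_⟧                 : G.Carrier → ℤ
      isGroupHomomorphism : IsGroupHomomorphism G.rawGroup (AbelianGroup.rawGroup ℤ.+-0-abelianGroup) ⟦_⟧
    open IsGroupHomomorphism isGroupHomomorphism public

  mkFunctional : (f : G.Carrier → ℤ) → (∀ {x y} → x G.≈ y → f x ≡ f y) →
                 (∀ x y → f (x G.∙ y) ≡ f x ℤ.+ f y) → Functional
  mkFunctional f f-cong f-homo = record { isGroupHomomorphism = mkGroupHom G ℤ.+-0-abelianGroup f f-cong f-homo }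

  module _ (f : Functional) where
    private module f = Functional f

    functional-eval : (h : X → G.Carrier) → ∀ t → f.⟦ eval G h t ⟧ ≡ evalℤ (λ x → f.⟦ h x ⟧) t
    functional-eval h = additive-unique ℤ.+-0-abelianGroup (λ t → f.⟦ eval G h t ⟧) _
      (record { 𝟎-homo = f.ε-homo ; ⊕-homo = λ _ _ → f.homo _ _ ; ⊖-homo = λ _ → f.⁻¹-homo _ })
      (eval-isAdditive _ _) (λ _ → refl)

    functional-·ℤ : ∀ m x → f.⟦ _·ℤ_ G m x ⟧ ≡ m ℤ.* f.⟦ x ⟧
    functional-·ℤ m x = go m
      where
      multiple : ∀ n → f.⟦ _·ℤ_ G (+ n) x ⟧ ≡ + n ℤ.* f.⟦ x ⟧
      multiple zero    = f.ε-homo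
      multiple (suc n) = trans (f.homo _ _) (trans (cong (ℤ._+_ f.⟦ x ⟧) (multiple n)) (sym (ℤ.suc-* (+ n) f.⟦ x ⟧)))
      go : ∀ m → f.⟦ _·ℤ_ G m x ⟧ ≡ m ℤ.* f.⟦ x ⟧
      go (+ n)    = multiple n
      go -[1+ n ] = trans (f.⁻¹-homo _) (trans (cong ℤ.-_ (multiple (suc n))) (ℤ.neg-distribˡ-* (+ suc n) f.⟦ x ⟧))

evalℤ-*ˡ : (c : ℤ) (f : X → ℤ) → ∀ t → evalℤ (λ x → c ℤ.* f x) t ≡ c ℤ.* evalℤ f t
evalℤ-*ˡ c f t = sym (functional-eval ℤ.+-0-abelianGroup
  (mkFunctional _ (c ℤ.*_) (cong (c ℤ.*_)) (ℤ.*-distribˡ-+ c)) f t)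

evalℤ-*ʳ : (c : ℤ) (f : X → ℤ) → ∀ t → evalℤ (λ x → f x ℤ.* c) t ≡ evalℤ f t ℤ.* c
evalℤ-*ʳ c f t = sym (functional-eval ℤ.+-0-abelianGroup
  (mkFunctional _ (ℤ._* c) (cong (ℤ._* c)) (ℤ.*-distribʳ-+ c)) f t)

-- Functionals on a graded connected Hopf algebra.

module GradedConnected {H : ℕ → AbelianGroup a ℓ} (hopf : GradedConnectedHopfAlgebra H) where
  open GradedConnectedHopfAlgebra hopf
  total : AbelianGroup a (a ⊔ ℓ)
  total = DirectSum.group H
  private
    module ε = IsRingHomomorphism ε-hom
    module R = Ring ring
    module S² = AbelianGroup square

  εᶠ : Functional total
  εᶠ = mkFunctional total ε ε.⟦⟧-cong ε.+-homo

  ∙-functionalˡ : Total → Functional total → Functional total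
  ∙-functionalˡ b f = mkFunctional total (λ a → f.⟦ b ∙ a ⟧) (λ e → f.⟦⟧-cong (R.*-congˡ e))
    (λ _ _ → trans (f.⟦⟧-cong (R.distribˡ b _ _)) (f.homo _ _))
    where module f = Functional f

  ∙-functionalʳ : Total → Functional total → Functional total
  ∙-functionalʳ b f = mkFunctional total (λ a → f.⟦ a ∙ b ⟧) (λ e → f.⟦⟧-cong (R.*-congʳ e))
    (λ _ _ → trans (f.⟦⟧-cong (R.distribʳ b _ _)) (f.homo _ _))
    where module f = Functional f

  module _ (f g : Functional total) where
    private
      module f = Functional f
      module g = Functional g

    -- Elements of the tensor square are only ever examined through such products of functionals,
    -- which keeps every calculation in ℤ.
    ⊗-functional : Expr (Total × Total) → ℤ
    ⊗-functional = evalℤ (λ (x , y) → f.⟦ x ⟧ ℤ.* g.⟦ y ⟧)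

    -- The product of two additive maps is bilinear, hence respects the tensor relations. `balanced`
    -- needs no case because its scalars range over the empty type.
    ⊗-functional-cong : ∀ {s t} → s S².≈ t → ⊗-functional s ≡ ⊗-functional t
    ⊗-functional-cong = eval-cong ℤ.+-0-abelianGroup λ where
      (Tensor.⊗-cong p q)        → cong₂ ℤ._*_ (f.⟦⟧-cong p) (g.⟦⟧-cong q)
      (Tensor.⊗-distribˡ m n n′) → trans (cong (f.⟦ m ⟧ ℤ.*_) (g.homo n n′)) (ℤ.*-distribˡ-+ f.⟦ m ⟧ _ _)
      (Tensor.⊗-distribʳ n m m′) → trans (cong (ℤ._* g.⟦ n ⟧) (f.homo m m′)) (ℤ.*-distribʳ-+ g.⟦ n ⟧ f.⟦ m ⟧ f.⟦ m′ ⟧)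

    ⊗-functional-* : ∀ s t → ⊗-functional (Ring._*_ (tensorSquare ring) s t) ≡
      evalℤ (λ (x , y) → evalℤ (λ (x′ , y′) → f.⟦ x ∙ x′ ⟧ ℤ.* g.⟦ y ∙ y′ ⟧) t) s
    ⊗-functional-* s t = trans (evalℤ-eval _ _ s) (evalℤ-cong (λ _ → evalℤ-eval _ _ t) s)

    ⊗-functional-include : ∀ k l t → ⊗-functional (include k l t) ≡ evalℤ (λ (x , y) → f.⟦ [ k , x ] ⟧ ℤ.* g.⟦ [ l , y ] ⟧) t
    ⊗-functional-include k l t = evalℤ-eval _ _ t

  module _ (f : Functional total) where
    private module f = Functional f

    ⊗-functional-counitˡ : ∀ z → ⊗-functional εᶠ f (Δ z) ≡ f.⟦ z ⟧
    ⊗-functional-counitˡ z = begin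
      ⊗-functional εᶠ f (Δ z)                            ≡⟨ evalℤ-cong (λ (x , y) → functional-·ℤ total f (ε x) y) (Δ z) ⟨
      evalℤ (λ (x , y) → f.⟦ _·ℤ_ total (ε x) y ⟧) (Δ z)  ≡⟨ functional-eval total f _ (Δ z) ⟨
      f.⟦ eval total (λ (x , y) → _·ℤ_ total (ε x) y) (Δ z) ⟧ ≡⟨ f.⟦⟧-cong (counitˡ z) ⟩
      f.⟦ z ⟧ ∎
      where open ≡-Reasoning

    ⊗-functional-counitʳ : ∀ z → ⊗-functional f εᶠ (Δ z) ≡ f.⟦ z ⟧
    ⊗-functional-counitʳ z = begin
      ⊗-functional f εᶠ (Δ z)                            ≡⟨ evalℤ-cong (λ (x , y) → trans (functional-·ℤ total f (ε y) x) (ℤ.*-comm (ε y) _)) (Δ z) ⟨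
      evalℤ (λ (x , y) → f.⟦ _·ℤ_ total (ε y) x ⟧) (Δ z)  ≡⟨ functional-eval total f _ (Δ z) ⟨
      f.⟦ eval total (λ (x , y) → _·ℤ_ total (ε y) x) (Δ z) ⟧ ≡⟨ f.⟦⟧-cong (counitʳ z) ⟩
      f.⟦ z ⟧ ∎
      where open ≡-Reasoning

    -- Connectedness makes `[ 0 , x ]` a multiple of `1#`, so in degree 0 every functional is a
    -- multiple of the counit.
    functional-degree0 : ∀ x → f.⟦ [ 0 , x ] ⟧ ≡ ε [ 0 , x ] ℤ.* f.⟦ 1# ⟧
    functional-degree0 x = trans (f.⟦⟧-cong (connected x)) (functional-·ℤ total f (ε [ 0 , x ]) 1#)

  -- The coproduct has components only in bidegrees (0,1) and (1,0). In each one the factor of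
  -- degree 0 is a multiple of `1#`, and the counit law identifies the remaining factor with
  -- `[ 1 , x ]`.
  degree1-primitive : ∀ f g x → ⊗-functional f g (Δ [ 1 , x ]) ≡
    Functional.⟦ f ⟧ [ 1 , x ] ℤ.* Functional.⟦ g ⟧ 1# ℤ.+ Functional.⟦ f ⟧ 1# ℤ.* Functional.⟦ g ⟧ [ 1 , x ]
  degree1-primitive f g x = begin
    ⊗-functional f g (Δ [ 1 , x ])  ≡⟨ split f g ⟩
    ⊗-functional f g t₀ ℤ.+ ⊗-functional f g t₁  ≡⟨ cong₂ ℤ._+_ left right ⟩
    f.⟦ 1# ⟧ ℤ.* g.⟦ [ 1 , x ] ⟧ ℤ.+ f.⟦ [ 1 , x ] ⟧ ℤ.* g.⟦ 1# ⟧ ≡⟨ ℤ.+-comm (f.⟦ 1# ⟧ ℤ.* g.⟦ [ 1 , x ] ⟧) _ ⟩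
    f.⟦ [ 1 , x ] ⟧ ℤ.* g.⟦ 1# ⟧ ℤ.+ f.⟦ 1# ⟧ ℤ.* g.⟦ [ 1 , x ] ⟧ ∎
    where
    open ≡-Reasoning
    module f = Functional f
    module g = Functional g
    components = proj₁ (Δ-graded 1 x)
    t₀ = include 0 1 (components zero)
    t₁ = include 1 0 (components (suc zero))
    -- Quantified afresh over the functionals, since `εᶠ` is also put in either slot. The identity
    -- law removes the zero that ends the sum over `Fin 2`.
    split : ∀ f g → ⊗-functional f g (Δ [ 1 , x ]) ≡ ⊗-functional f g t₀ ℤ.+ ⊗-functional f g t₁
    split f g = trans (⊗-functional-cong f g (proj₂ (Δ-graded 1 x)))
      (cong (ℤ._+_ (⊗-functional f g t₀)) (ℤ.+-identityʳ (⊗-functional f g t₁)))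
    ε₁ : ⊗-functional εᶠ g t₁ ≡ 0ℤ
    ε₁ = trans (⊗-functional-include εᶠ g 1 0 (components (suc zero))) (trans
      (evalℤ-cong (λ (x , y) → cong (ℤ._* g.⟦ [ 0 , y ] ⟧) (ε-graded 0 x)) (components (suc zero))) (evalℤ-0 (components (suc zero))))
    ε₀ : ⊗-functional f εᶠ t₀ ≡ 0ℤ
    ε₀ = trans (⊗-functional-include f εᶠ 0 1 (components zero)) (trans
      (evalℤ-cong (λ (x , y) → trans (cong (f.⟦ [ 0 , x ] ⟧ ℤ.*_) (ε-graded 0 y)) (ℤ.*-zeroʳ f.⟦ [ 0 , x ] ⟧)) (components zero)) (evalℤ-0 (components zero)))
    left : ⊗-functional f g t₀ ≡ f.⟦ 1# ⟧ ℤ.* g.⟦ [ 1 , x ] ⟧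
    left = begin
      ⊗-functional f g t₀  ≡⟨ ⊗-functional-include f g 0 1 (components zero) ⟩
      -- On the factor of degree 0, `f` becomes its value at `1#` times the counit.
      _ ≡⟨ evalℤ-cong (λ (x , y) → trans (cong (ℤ._* g.⟦ [ 1 , y ] ⟧) (trans (functional-degree0 f x) (ℤ.*-comm (ε [ 0 , x ]) f.⟦ 1# ⟧)))
                                     (ℤ.*-assoc f.⟦ 1# ⟧ _ _)) (components zero) ⟩
      _ ≡⟨ evalℤ-*ˡ f.⟦ 1# ⟧ _ (components zero) ⟩
      _ ≡⟨ cong (f.⟦ 1# ⟧ ℤ.*_) (⊗-functional-include εᶠ g 0 1 (components zero)) ⟨
      -- Adding the `t₁` term, which is zero because the counit kills degree 1, restores the whole
      -- coproduct, and the counit law applies.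
      f.⟦ 1# ⟧ ℤ.* ⊗-functional εᶠ g t₀ ≡⟨ cong (f.⟦ 1# ⟧ ℤ.*_) (ℤ.+-identityʳ (⊗-functional εᶠ g t₀)) ⟨
      f.⟦ 1# ⟧ ℤ.* (⊗-functional εᶠ g t₀ ℤ.+ 0ℤ) ≡⟨ cong (λ z → f.⟦ 1# ⟧ ℤ.* (⊗-functional εᶠ g t₀ ℤ.+ z)) ε₁ ⟨
      _ ≡⟨ cong (f.⟦ 1# ⟧ ℤ.*_) (split εᶠ g) ⟨
      _ ≡⟨ cong (f.⟦ 1# ⟧ ℤ.*_) (⊗-functional-counitˡ g [ 1 , x ]) ⟩
      f.⟦ 1# ⟧ ℤ.* g.⟦ [ 1 , x ] ⟧ ∎
    right : ⊗-functional f g t₁ ≡ f.⟦ [ 1 , x ] ⟧ ℤ.* g.⟦ 1# ⟧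
    right = begin
      ⊗-functional f g t₁  ≡⟨ ⊗-functional-include f g 1 0 (components (suc zero)) ⟩
      _ ≡⟨ evalℤ-cong (λ (x , y) → trans (cong (f.⟦ [ 1 , x ] ⟧ ℤ.*_) (functional-degree0 g y))
                                     (sym (ℤ.*-assoc f.⟦ [ 1 , x ] ⟧ _ _))) (components (suc zero)) ⟩
      _ ≡⟨ evalℤ-*ʳ g.⟦ 1# ⟧ _ (components (suc zero)) ⟩
      _ ≡⟨ cong (ℤ._* g.⟦ 1# ⟧) (⊗-functional-include f εᶠ 1 0 (components (suc zero))) ⟨
      ⊗-functional f εᶠ t₁ ℤ.* g.⟦ 1# ⟧ ≡⟨ cong (ℤ._* g.⟦ 1# ⟧) (ℤ.+-identityˡ (⊗-functional f εᶠ t₁)) ⟨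
      (0ℤ ℤ.+ ⊗-functional f εᶠ t₁) ℤ.* g.⟦ 1# ⟧ ≡⟨ cong (λ z → (z ℤ.+ ⊗-functional f εᶠ t₁) ℤ.* g.⟦ 1# ⟧) ε₀ ⟨
      _ ≡⟨ cong (ℤ._* g.⟦ 1# ⟧) (split f εᶠ) ⟨
      _ ≡⟨ cong (ℤ._* g.⟦ 1# ⟧) (⊗-functional-counitʳ f [ 1 , x ]) ⟩
      f.⟦ [ 1 , x ] ⟧ ℤ.* g.⟦ 1# ⟧ ∎

-- Zero and regular modules, and isomorphic modules in a Grothendieck group.

zeroModule : (R : Ring 0ℓ 0ℓ) → Mod R
zeroModule R = Zero.leftModule

module _ (R : Ring 0ℓ 0ℓ) where
  private module R = Ring R

  zero-fg : IsFinitelyGenerated (zeroModule R)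
  zero-fg = finitelyGenerated 0 (λ ()) (λ _ → (λ ()) , tt)

  zero-projective : IsProjective (zeroModule R)
  IsProjective.lift zero-projective M N g _ f =
    mkHom (zeroModule R) M (λ _ → M.0ᴹ) (λ _ → M.≈ᴹ-refl) (λ _ _ → M.≈ᴹ-sym (M.+ᴹ-identityˡ _)) (λ r _ → M.≈ᴹ-sym (M.*ₗ-zeroʳ r)) ,
    λ _ → N.≈ᴹ-trans (Hom.0ᴹ-homo g) (N.≈ᴹ-sym (Hom.0ᴹ-homo f))
    where
    module M = LeftModule M
    module N = LeftModule N

  regular-fg : IsFinitelyGenerated (regular R)
  regular-fg = finitelyGenerated 1 (λ _ → R.1#) λ r → (λ _ → r) ,
    R.sym (R.trans (R.+-identityʳ _) (R.*-identityʳ r))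

  -- The regular module is free on 1, so a lift is given by a preimage `m` of the image of 1.
  regular-projective : IsProjective (regular R)
  IsProjective.lift regular-projective M N g g-surj f =
    mkHom (regular R) M (M._*ₗ m) M.*ₗ-congʳ (λ r s → M.*ₗ-distribʳ m r s) (λ r s → M.*ₗ-assoc r s m) ,
    λ r → N.≈ᴹ-trans (Hom.*ₗ-homo g r m) (N.≈ᴹ-trans (N.*ₗ-congˡ (proj₂ (g-surj (Hom.⟦ f ⟧ R.1#)) M.≈ᴹ-refl))
      (N.≈ᴹ-trans (N.≈ᴹ-sym (Hom.*ₗ-homo f r R.1#)) (Hom.⟦⟧-cong f (R.*-identityʳ r))))
    where
    module M = LeftModule M
    module N = LeftModule N
    m = proj₁ (g-surj (Hom.⟦ f ⟧ R.1#))

  regular-hom-ext : {M : Mod R} (f h : Hom (regular R) M) → LeftModule._≈ᴹ_ M (Hom.⟦ f ⟧ R.1#) (Hom.⟦ h ⟧ R.1#) →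
                    ∀ r → LeftModule._≈ᴹ_ M (Hom.⟦ f ⟧ r) (Hom.⟦ h ⟧ r)
  regular-hom-ext {M} f h e r = begin
    Hom.⟦ f ⟧ r              ≈⟨ Hom.⟦⟧-cong f (R.*-identityʳ r) ⟨
    Hom.⟦ f ⟧ (r R.* R.1#)   ≈⟨ Hom.*ₗ-homo f r R.1# ⟩
    r M.*ₗ Hom.⟦ f ⟧ R.1#    ≈⟨ M.*ₗ-congˡ e ⟩
    r M.*ₗ Hom.⟦ h ⟧ R.1#    ≈⟨ Hom.*ₗ-homo h r R.1# ⟨
    Hom.⟦ h ⟧ (r R.* R.1#)   ≈⟨ Hom.⟦⟧-cong h (R.*-identityʳ r) ⟩
    Hom.⟦ h ⟧ r              ∎
    where
    module M = LeftModule M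
    open import Relation.Binary.Reasoning.Setoid M.≈ᴹ-setoid

module _ {p : Level} {R : Ring 0ℓ 0ℓ} {𝒞 : Mod R → Set p} (zero∈𝒞 : 𝒞 (zeroModule R)) where
  open Grothendieck R 𝒞 using (Object; exact; relation; group) renaming (_≈_ to _≈ᴷ_)
  private module K = AbelianGroup group

  private
    Z : Object
    Z = zeroModule R , zero∈𝒞

  -- The exact sequence with all three terms zero gives [Z] = [Z] + [Z].
  class-zero : [ Z ] ≈ᴷ 𝟎
  class-zero = identityˡ-unique _ _ (K.sym (relation (exact Z Z Z (record
    { incl = id₀
    ; proj = id₀
    ; incl-injective = λ _ → tt
    ; proj-surjective = λ _ → tt , λ _ → tt
    ; ker⊆im = λ _ _ → tt , tt
    ; im⊆ker = λ _ → tt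
    }))))
    where
    id₀ : Hom (zeroModule R) (zeroModule R)
    id₀ = mkHom (zeroModule R) (zeroModule R) id (λ _ → tt) (λ _ _ → tt) (λ _ _ → tt)
    open import Algebra.Properties.Group K.group using (identityˡ-unique)

  -- The group has only relations from exact sequences, so an isomorphism of `L` with `M` enters as
  -- an exact sequence whose last term is zero.
  class-cong : (L M : Object) → ShortExact (proj₁ L) (proj₁ M) (zeroModule R) → [ M ] ≈ᴷ [ L ]
  class-cong L M e = K.trans (relation (exact L M Z e))
    (K.trans (K.∙-congˡ {[ L ]} class-zero) (K.identityʳ [ L ]))

-- Induction, endomorphisms and dimensions of regular modules.

module RegularModules (k : CommutativeRing 0ℓ 0ℓ) where
  open Over k
  private module k = CommutativeRing k

  module _ (A B : Algebra) {S : Ring 0ℓ 0ℓ} (φ : RingHom (Algebra.ring (A ⊗ᴬ B)) S) where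
    private
      module S = Ring S
      module φ = RingHom φ
      module A⊗B = Algebra (A ⊗ᴬ B)
      regular⊠regular = outer A B (regular (Algebra.ring A)) (regular (Algebra.ring B))
      module I = Induction φ regular⊠regular

    -- The outer product of the regular modules is the regular module of `A ⊗ᴬ B`, so this is the
    -- isomorphism of S ⊗_R R with S, in the form that `class-cong` takes. The inverse of s ↦ s ⊗ 1
    -- is `multiply`.
    ind-regular : ShortExact (regular S) I.ind (zeroModule S)
    ind-regular = record
      { incl = mkHom (regular S) I.ind (I._⊗ A⊗B.1#) (λ e → I.relation (I.⊗-cong e A⊗B.refl))
          (λ s s′ → I.relation (I.⊗-distribʳ _ s s′)) (λ _ _ → I.refl)
      ; proj = mkHom I.ind (zeroModule S) (λ _ → tt) (λ _ → tt) (λ _ _ → tt) (λ _ _ → tt)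
      ; incl-injective = λ {s} {s′} e → S.trans (S.sym (multiply-1 s)) (S.trans (multiply-cong e) (multiply-1 s′))
      ; proj-surjective = λ _ → 𝟎 , λ _ → tt
      ; ker⊆im = λ t _ → multiply t , unique t
      ; im⊆ker = λ _ → tt
      }
      where
      value : S.Carrier × A⊗B.Carrier → S.Carrier
      value (s , x) = s S.* φ.⟦ x ⟧
      multiply : Expr (S.Carrier × A⊗B.Carrier) → S.Carrier
      multiply = eval S.+-abelianGroup value
      multiply-cong : ∀ {t t′} → t I.≈ t′ → multiply t S.≈ multiply t′
      multiply-cong = I.IsBalanced.induced-cong {G = S.+-abelianGroup} {f = value} (record
        { f-cong = λ e e′ → S.*-cong e (φ.⟦⟧-cong e′)
        ; f-distribˡ = λ s x y → S.trans (S.*-congˡ (φ.+-homo x y)) (S.distribˡ s _ _)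
        ; f-distribʳ = λ x s s′ → S.distribʳ _ s s′
        ; f-balanced = λ s r x → S.trans (S.*-assoc _ _ _) (S.*-congˡ (S.sym (φ.*-homo r x)))
        })
      multiply-1 : ∀ s → multiply (s I.⊗ A⊗B.1#) S.≈ s
      multiply-1 s = S.trans (S.*-congˡ φ.1#-homo) (S.*-identityʳ s)
      unique : ∀ t → (multiply t I.⊗ A⊗B.1#) I.≈ t
      unique = additive-unique I.group (λ t → multiply t I.⊗ A⊗B.1#) id
        (record { 𝟎-homo = ⊗1.ε-homo ; ⊕-homo = λ _ _ → ⊗1.homo _ _ ; ⊖-homo = λ _ → ⊗1.⁻¹-homo _ })
        (record { 𝟎-homo = I.refl ; ⊕-homo = λ _ _ → I.refl ; ⊖-homo = λ _ → I.refl })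
        -- `balanced` moves `x` across the tensor sign: s φ(x) ⊗ 1 = s ⊗ x 1.
        (λ (s , x) → I.trans (I.relation (I.balanced s x A⊗B.1#)) (I.relation (I.⊗-cong S.refl (A⊗B.*-identityʳ x))))
        where
        module ⊗1 = IsGroupHomomorphism (mkGroupHom S.+-abelianGroup I.group (I._⊗ A⊗B.1#)
          (λ e → I.relation (I.⊗-cong e A⊗B.refl)) (λ s s′ → I.relation (I.⊗-distribʳ _ s s′)))

  module _ (A : Algebra) where
    private
      module A = Algebra A
      V = underlying A (regular A.ring)
      End = homSpace A (regular A.ring) (regular A.ring)
      module V = LeftModule V
      module End = LeftModule End
      module ι = RingHom A.ι

    -- Evaluation at 1 identifies the endomorphisms of the regular module with the algebra. Its
    -- inverse sends an element to right multiplication by it, so a basis is carried to a basis.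
    regular-endomorphisms : ∀ {d} → HasDimension V d → HasDimension End d
    regular-endomorphisms {d} (b , spans , independent) = right-multiplication , spanning , independence
      where
      right-multiplication : Fin d → End.Carrierᴹ
      right-multiplication i = mkHom (regular A.ring) (regular A.ring) (A._* b i) A.*-congʳ
        (λ x y → A.distribʳ (b i) x y) (λ x y → A.*-assoc x y (b i))
      at-1 : ∀ c → Hom.⟦ LinearCombination.combination End c right-multiplication ⟧ A.1# A.≈ LinearCombination.combination V c b
      at-1 c = A.trans
        (sum-homo End.+ᴹ-abelianGroup V.+ᴹ-abelianGroup (λ f → Hom.⟦ f ⟧ A.1#) (λ e → e A.1#) (λ _ _ → A.refl)
          (λ i → c i End.*ₗ right-multiplication i))
        (Sum.sum-cong-≋ V.+ᴹ-commutativeMonoid (λ i → A.*-congˡ (A.*-identityˡ (b i))))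
      spanning : ∀ f → Σ (Fin d → k.Carrier) λ c → f End.≈ᴹ LinearCombination.combination End c right-multiplication
      spanning f = let (c , e) = spans (Hom.⟦ f ⟧ A.1#) in
        c , regular-hom-ext A.ring {regular A.ring} f (LinearCombination.combination End c right-multiplication) (A.trans e (A.sym (at-1 c)))
      independence : ∀ c → LinearCombination.combination End c right-multiplication End.≈ᴹ End.0ᴹ → ∀ i → c i k.≈ k.0#
      independence c e = independent c (A.trans (A.sym (at-1 c)) (e A.1#))

    -- The basis is the unit alone: the coordinate of `a` is its image under `f`, since `f` is
    -- injective and inverts the structure map on scalars.
    base-dimension : (f : AlgHom A base) → Bijective A._≈_ k._≈_ (AlgHom.⟦_⟧ f) → HasDimension V 1
    base-dimension f (f-inj , _) = (λ _ → A.1#) ,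
      (λ a → (λ _ → f.⟦ a ⟧) , f-inj (k.trans (k.sym (f.ι-homo f.⟦ a ⟧)) (f.⟦⟧-cong (A.sym (scalar f.⟦ a ⟧))))) ,
      λ { c e zero → k.trans (k.sym (f.ι-homo (c zero))) (k.trans (f.⟦⟧-cong (A.trans (A.sym (scalar (c zero))) e)) f.0#-homo) }
      where
      module f = AlgHom f
      scalar : ∀ z → ι.⟦ z ⟧ A.* A.1# A.+ A.0# A.≈ ι.⟦ z ⟧
      scalar z = A.trans (A.+-identityʳ _) (A.*-identityʳ _)

-- Regular classes and their pairing in a dual pair.

module DualHopfTower (k : CommutativeRing 0ℓ 0ℓ) (T : Towers.Tower k) where
  open Over k
  open Towers k
  open Tower T
  open RegularModules k

  module _ {p : Level} (class : ModuleClass T p) (hopf : GrothendieckHopf T class)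
    (zero∈𝒞 : ∀ R → ModuleClass.𝒞 class (zeroModule R)) (regular∈𝒞 : ∀ R → ModuleClass.𝒞 class (regular R)) where
    open GrothendieckHopf hopf

    regular-∙ : ∀ m n → let P = λ n → [ n , [ regular (Algebra.ring (A n)) , regular∈𝒞 (Algebra.ring (A n)) ] ] in
                P m ∙ P n ≈ P (m + n)
    regular-∙ m n = DirectSum.trans (∙-class m n _ _) (DirectSum.relation (DirectSum.homogeneous-cong
      (class-cong (zero∈𝒞 _) _ _ (ind-regular (A m) (A n) (AlgHom.ringHom (ρ m n))))))

  module _ (dual : FormDualHopfAlgebras T) where
    open FormDualHopfAlgebras dual
    private
      module KAʳ = Ring KA.ring
      module GAʳ = Ring GA.ring
      module KAᶠ = GradedConnected KA.hopf
      module GAᶠ = GradedConnected GA.hopf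
      module KΔ = IsRingHomomorphism KA.Δ-hom
      module Gε = IsRingHomomorphism GA.ε-hom

      regularᴷ : ∀ n → Kₙ.Carrier n
      regularᴷ n = [ regular R , regular-fg R , regular-projective R ]
        where R = Algebra.ring (A n)

      regularᴳ : ∀ n → Gₙ.Carrier n
      regularᴳ n = [ regular R , regular-fg R ]
        where R = Algebra.ring (A n)

      P : ℕ → KA.Total
      P n = [ n , regularᴷ n ]

      Q : ℕ → GA.Total
      Q n = [ n , regularᴳ n ]

    P-∙ : ∀ m n → P m KA.∙ P n KA.≈ P (m + n)
    P-∙ = regular-∙ (fgProjective T) KA (λ R → zero-fg R , zero-projective R) (λ R → regular-fg R , regular-projective R)

    Q-∙ : ∀ m n → Q m GA.∙ Q n GA.≈ Q (m + n)
    Q-∙ = regular-∙ (fg T) GA zero-fg regular-fg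

    ⟨P,Q⟩ : ∀ n {d} → HasDimension (underlying (A n) (regular (Algebra.ring (A n)))) d → ⟨ P n , Q n ⟩ ≡ + d
    ⟨P,Q⟩ n h = ⟨⟩-class n _ _ _ (regular-endomorphisms (A n) h)

    ⟨-,_⟩ : GA.Total → Functional KAᶠ.total
    ⟨-, x ⟩ = mkFunctional _ (λ a → ⟨ a , x ⟩) (λ e → ⟨⟩-cong e GAʳ.refl) (λ a b → ⟨⟩-addˡ a b x)

    ⟨_,-⟩ : KA.Total → Functional GAᶠ.total
    ⟨ a ,-⟩ = mkFunctional _ (λ x → ⟨ a , x ⟩) (λ e → ⟨⟩-cong KAʳ.refl e) (⟨⟩-addʳ a)

    -- By adjointness and primitivity of `[ 1 , x ]`, pairing with it is a derivation relative to
    -- the counit.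
    ⟨∙,degree1⟩ : ∀ a b x → ⟨ a KA.∙ b , [ 1 , x ] ⟩ ≡ ⟨ a , [ 1 , x ] ⟩ ℤ.* KA.ε b ℤ.+ KA.ε a ℤ.* ⟨ b , [ 1 , x ] ⟩
    ⟨∙,degree1⟩ a b x = trans (∙-Δ-adjoint a b [ 1 , x ]) (trans (GAᶠ.degree1-primitive ⟨ a ,-⟩ ⟨ b ,-⟩ x)
      (cong₂ ℤ._+_ (cong (⟨ a , [ 1 , x ] ⟩ ℤ.*_) (ε-1-adjoint b)) (cong (ℤ._* ⟨ b , [ 1 , x ] ⟩) (ε-1-adjoint a))))

    -- The Heisenberg relation and powers of a class of degree 1.

    module _ (α : Kₙ.Carrier 1) (ξ : Gₙ.Carrier 1) where
      private
        p : KA.Total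
        p = [ 1 , α ]
        q : GA.Total
        q = [ 1 , ξ ]

      ⟨1,q⟩ : ⟨ KA.1# , q ⟩ ≡ 0ℤ
      ⟨1,q⟩ = trans (1-ε-adjoint q) (GA.ε-graded 0 ξ)

      -- The Heisenberg commutation relation between multiplication by p and the adjoint
      -- of multiplication by q, paired with y.
      heisenberg : ∀ a y → ⟨ p KA.∙ a , q GA.∙ y ⟩ ≡
        ⟨ p , q ⟩ ℤ.* ⟨ a , y ⟩ ℤ.+ evalℤ (λ (y′ , y″) → ⟨ p , y′ ⟩ ℤ.* ⟨ a , q GA.∙ y″ ⟩) (GA.Δ y)
      heisenberg a y = begin
        ⟨ p KA.∙ a , q GA.∙ y ⟩
          ≡⟨ Δ-∙-adjoint (p KA.∙ a) q y ⟩
        KAᶠ.⊗-functional ⟨-, q ⟩ ⟨-, y ⟩ (KA.Δ (p KA.∙ a))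
          ≡⟨ KAᶠ.⊗-functional-cong ⟨-, q ⟩ ⟨-, y ⟩ (KΔ.*-homo p a) ⟩
        KAᶠ.⊗-functional ⟨-, q ⟩ ⟨-, y ⟩ (Ring._*_ (tensorSquare KA.ring) (KA.Δ p) (KA.Δ a))
          ≡⟨ KAᶠ.⊗-functional-* ⟨-, q ⟩ ⟨-, y ⟩ (KA.Δ p) (KA.Δ a) ⟩
        evalℤ (λ (p′ , p″) → evalℤ (λ (a′ , a″) → ⟨ p′ KA.∙ a′ , q ⟩ ℤ.* ⟨ p″ KA.∙ a″ , y ⟩) (KA.Δ a)) (KA.Δ p)
          ≡⟨ evalℤ-cong (λ (p′ , p″) → inner p′ p″) (KA.Δ p) ⟩
        evalℤ (λ (p′ , p″) → ⟨ p′ , q ⟩ ℤ.* ⟨ p″ KA.∙ a , y ⟩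
          ℤ.+ evalℤ (λ (a′ , a″) → KA.ε p′ ℤ.* (⟨ a′ , q ⟩ ℤ.* ⟨ p″ KA.∙ a″ , y ⟩)) (KA.Δ a)) (KA.Δ p)
          ≡⟨ evalℤ-+ _ _ (KA.Δ p) ⟩
        _ ≡⟨ cong₂ ℤ._+_ first (trans (evalℤ-swap (λ (p′ , p″) (a′ , a″) → KA.ε p′ ℤ.* (⟨ a′ , q ⟩ ℤ.* ⟨ p″ KA.∙ a″ , y ⟩)) (KA.Δ p) (KA.Δ a)) second) ⟩
        _ ∎
        where
        open ≡-Reasoning
        expand : ∀ u v w x z → (u ℤ.* v ℤ.+ w ℤ.* x) ℤ.* z ≡ u ℤ.* (v ℤ.* z) ℤ.+ w ℤ.* (x ℤ.* z)
        expand = solve-∀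
        exchange : ∀ u v w → u ℤ.* (v ℤ.* w) ≡ v ℤ.* (u ℤ.* w)
        exchange = solve-∀
        -- The derivation rule splits the first factor in two; in the term containing `KA.ε a′` the
        -- counit law collapses the coproduct of `a`.
        inner : ∀ p′ p″ → evalℤ (λ (a′ , a″) → ⟨ p′ KA.∙ a′ , q ⟩ ℤ.* ⟨ p″ KA.∙ a″ , y ⟩) (KA.Δ a) ≡
          ⟨ p′ , q ⟩ ℤ.* ⟨ p″ KA.∙ a , y ⟩ ℤ.+ evalℤ (λ (a′ , a″) → KA.ε p′ ℤ.* (⟨ a′ , q ⟩ ℤ.* ⟨ p″ KA.∙ a″ , y ⟩)) (KA.Δ a)
        inner p′ p″ = begin
          _ ≡⟨ evalℤ-cong (λ (a′ , a″) → trans (cong (ℤ._* ⟨ p″ KA.∙ a″ , y ⟩) (⟨∙,degree1⟩ p′ a′ ξ))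
                 (expand ⟨ p′ , q ⟩ (KA.ε a′) (KA.ε p′) ⟨ a′ , q ⟩ ⟨ p″ KA.∙ a″ , y ⟩)) (KA.Δ a) ⟩
          _ ≡⟨ evalℤ-+ (λ (a′ , a″) → ⟨ p′ , q ⟩ ℤ.* (KA.ε a′ ℤ.* ⟨ p″ KA.∙ a″ , y ⟩)) _ (KA.Δ a) ⟩
          _ ≡⟨ cong (ℤ._+ evalℤ (λ (a′ , a″) → KA.ε p′ ℤ.* (⟨ a′ , q ⟩ ℤ.* ⟨ p″ KA.∙ a″ , y ⟩)) (KA.Δ a)) (trans (evalℤ-*ˡ ⟨ p′ , q ⟩ _ (KA.Δ a))
                 (cong (⟨ p′ , q ⟩ ℤ.*_) (KAᶠ.⊗-functional-counitˡ (KAᶠ.∙-functionalˡ p″ ⟨-, y ⟩) a))) ⟩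
          _ ∎
        -- Primitivity of `p` leaves two terms, and the one with ⟨1, q⟩ vanishes.
        first : evalℤ (λ (p′ , p″) → ⟨ p′ , q ⟩ ℤ.* ⟨ p″ KA.∙ a , y ⟩) (KA.Δ p) ≡ ⟨ p , q ⟩ ℤ.* ⟨ a , y ⟩
        first = begin
          _ ≡⟨ KAᶠ.degree1-primitive ⟨-, q ⟩ (KAᶠ.∙-functionalʳ a ⟨-, y ⟩) α ⟩
          ⟨ p , q ⟩ ℤ.* ⟨ KA.1# KA.∙ a , y ⟩ ℤ.+ ⟨ KA.1# , q ⟩ ℤ.* ⟨ p KA.∙ a , y ⟩
            ≡⟨ cong₂ ℤ._+_ (cong (⟨ p , q ⟩ ℤ.*_) (⟨⟩-cong (KAʳ.*-identityˡ a) GAʳ.refl)) (cong (ℤ._* ⟨ p KA.∙ a , y ⟩) ⟨1,q⟩) ⟩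
          ⟨ p , q ⟩ ℤ.* ⟨ a , y ⟩ ℤ.+ 0ℤ
            ≡⟨ ℤ.+-identityʳ _ ⟩
          ⟨ p , q ⟩ ℤ.* ⟨ a , y ⟩ ∎
        -- The counit law collapses the coproduct of `p`, adjointness moves `p` onto the coproduct
        -- of `y`, and after the swap the sum over the coproduct of `a` reassembles into a pairing
        -- with `q GA.∙ y″`.
        second : evalℤ (λ (a′ , a″) → evalℤ (λ (p′ , p″) → KA.ε p′ ℤ.* (⟨ a′ , q ⟩ ℤ.* ⟨ p″ KA.∙ a″ , y ⟩)) (KA.Δ p)) (KA.Δ a) ≡
          evalℤ (λ (y′ , y″) → ⟨ p , y′ ⟩ ℤ.* ⟨ a , q GA.∙ y″ ⟩) (GA.Δ y)
        second = begin
          _ ≡⟨ evalℤ-cong (λ (a′ , a″) → begin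
                 _ ≡⟨ evalℤ-cong (λ (p′ , p″) → exchange (KA.ε p′) ⟨ a′ , q ⟩ ⟨ p″ KA.∙ a″ , y ⟩) (KA.Δ p) ⟩
                 _ ≡⟨ evalℤ-*ˡ ⟨ a′ , q ⟩ _ (KA.Δ p) ⟩
                 _ ≡⟨ cong (⟨ a′ , q ⟩ ℤ.*_) (KAᶠ.⊗-functional-counitˡ (KAᶠ.∙-functionalʳ a″ ⟨-, y ⟩) p) ⟩
                 _ ≡⟨ cong (⟨ a′ , q ⟩ ℤ.*_) (∙-Δ-adjoint p a″ y) ⟩
                 _ ≡⟨ evalℤ-*ˡ ⟨ a′ , q ⟩ _ (GA.Δ y) ⟨
                 evalℤ (λ (y′ , y″) → ⟨ a′ , q ⟩ ℤ.* (⟨ p , y′ ⟩ ℤ.* ⟨ a″ , y″ ⟩)) (GA.Δ y) ∎) (KA.Δ a) ⟩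
          _ ≡⟨ evalℤ-swap (λ (a′ , a″) (y′ , y″) → ⟨ a′ , q ⟩ ℤ.* (⟨ p , y′ ⟩ ℤ.* ⟨ a″ , y″ ⟩)) (KA.Δ a) (GA.Δ y) ⟩
          _ ≡⟨ evalℤ-cong (λ (y′ , y″) → begin
                 _ ≡⟨ evalℤ-cong (λ (a′ , a″) → exchange ⟨ a′ , q ⟩ ⟨ p , y′ ⟩ ⟨ a″ , y″ ⟩) (KA.Δ a) ⟩
                 _ ≡⟨ evalℤ-*ˡ ⟨ p , y′ ⟩ _ (KA.Δ a) ⟩
                 _ ≡⟨ cong (⟨ p , y′ ⟩ ℤ.*_) (Δ-∙-adjoint a q y″) ⟨
                 ⟨ p , y′ ⟩ ℤ.* ⟨ a , q GA.∙ y″ ⟩ ∎) (GA.Δ y) ⟩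
          _ ∎

      power : ℕ → KA.Total
      power zero    = KA.1#
      power (suc n) = p KA.∙ power n

      -- The adjoint of multiplication by `q` acts on powers of `p` as ⟨p, q⟩ times d/dp. It kills
      -- the unit, and each further factor `p` contributes one more term by `heisenberg`.
      ⟨power,q∙⟩ : ∀ n y → ⟨ power (suc n) , q GA.∙ y ⟩ ≡ + suc n ℤ.* (⟨ p , q ⟩ ℤ.* ⟨ power n , y ⟩)
      ⟨power,q∙⟩ zero y = begin
        _ ≡⟨ heisenberg KA.1# y ⟩
        _ ≡⟨ cong (ℤ._+_ (⟨ p , q ⟩ ℤ.* ⟨ KA.1# , y ⟩)) (trans (evalℤ-cong (λ (y′ , y″) → vanishes y′ y″) (GA.Δ y)) (evalℤ-0 (GA.Δ y))) ⟩
        ⟨ p , q ⟩ ℤ.* ⟨ KA.1# , y ⟩ ℤ.+ 0ℤ ≡⟨ ℤ.+-identityʳ _ ⟩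
        ⟨ p , q ⟩ ℤ.* ⟨ KA.1# , y ⟩ ≡⟨ ℤ.*-identityˡ _ ⟨
        1ℤ ℤ.* (⟨ p , q ⟩ ℤ.* ⟨ KA.1# , y ⟩) ∎
        where
        open ≡-Reasoning
        -- The unit pairs as the counit, which is multiplicative and zero on `q`.
        vanishes : ∀ y′ y″ → ⟨ p , y′ ⟩ ℤ.* ⟨ KA.1# , q GA.∙ y″ ⟩ ≡ 0ℤ
        vanishes y′ y″ = begin
          _ ≡⟨ cong (⟨ p , y′ ⟩ ℤ.*_) (1-ε-adjoint (q GA.∙ y″)) ⟩
          _ ≡⟨ cong (⟨ p , y′ ⟩ ℤ.*_) (Gε.*-homo q y″) ⟩
          _ ≡⟨ cong (λ z → ⟨ p , y′ ⟩ ℤ.* (z ℤ.* GA.ε y″)) (GA.ε-graded 0 ξ) ⟩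
          _ ≡⟨ ℤ.*-zeroʳ ⟨ p , y′ ⟩ ⟩
          0ℤ ∎
      ⟨power,q∙⟩ (suc n) y = begin
        _ ≡⟨ heisenberg (power (suc n)) y ⟩
        _ ≡⟨ cong (ℤ._+_ (d ℤ.* ⟨ power (suc n) , y ⟩)) (begin
               _ ≡⟨ evalℤ-cong (λ (y′ , y″) → trans (cong (⟨ p , y′ ⟩ ℤ.*_) (⟨power,q∙⟩ n y″))
                      (rearrange ⟨ p , y′ ⟩ (+ suc n) d ⟨ power n , y″ ⟩)) (GA.Δ y) ⟩
               _ ≡⟨ evalℤ-*ˡ (+ suc n ℤ.* d) _ (GA.Δ y) ⟩
               -- Once the induction hypothesis has been applied under the sum, adjointness folds
               -- the coproduct of `y` back into one further factor `p`.
               _ ≡⟨ cong (+ suc n ℤ.* d ℤ.*_) (∙-Δ-adjoint p (power n) y) ⟨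
               + suc n ℤ.* d ℤ.* ⟨ power (suc n) , y ⟩ ∎) ⟩
        d ℤ.* ⟨ power (suc n) , y ⟩ ℤ.+ + suc n ℤ.* d ℤ.* ⟨ power (suc n) , y ⟩ ≡⟨ collect (+ suc n) d ⟨ power (suc n) , y ⟩ ⟩
        + suc (suc n) ℤ.* (d ℤ.* ⟨ power (suc n) , y ⟩) ∎
        where
        open ≡-Reasoning
        d = ⟨ p , q ⟩
        rearrange : ∀ u v w x → u ℤ.* (v ℤ.* (w ℤ.* x)) ≡ v ℤ.* w ℤ.* (u ℤ.* x)
        rearrange = solve-∀
        collect : ∀ m d x → d ℤ.* x ℤ.+ m ℤ.* d ℤ.* x ≡ (1ℤ ℤ.+ m) ℤ.* (d ℤ.* x)
        collect = solve-∀

    -- The recursion for the dimensions.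

    power-P : ∀ n → power (regularᴷ 1) (regularᴳ 1) (suc n) KA.≈ P (suc n)
    power-P zero    = KAʳ.*-identityʳ (P 1)
    power-P (suc n) = KAʳ.trans (KAʳ.*-congˡ {P 1} (power-P n)) (P-∙ 1 (suc n))

    ⟨P,Q⟩-dim : ∀ n → ⟨ P n , Q n ⟩ ≡ + dim n
    ⟨P,Q⟩-dim n = ⟨P,Q⟩ n (proj₂ (finiteDimensional n))

    -- The chosen basis and the one from `base-dimension` give the same pairing ⟨P 0, Q 0⟩.
    dim-zero : dim 0 ≡ 1
    dim-zero = ℤ.+-injective (trans (sym (⟨P,Q⟩-dim 0)) (⟨P,Q⟩ 0 (base-dimension (A 0) (proj₁ A₀≅k) (proj₂ A₀≅k))))

    -- Starts in degree 2 because `power-P` identifies powers with regular classes only from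
    -- exponent 1 on; degrees 0 and 1 are settled separately in `dim-formula`.
    dim-suc : ∀ n → dim (2 + n) ≡ (2 + n) * (dim 1 * dim (1 + n))
    dim-suc n = ℤ.+-injective (begin
      + dim (2 + n)
        ≡⟨ ⟨P,Q⟩-dim (2 + n) ⟨
      ⟨ P (2 + n) , Q (2 + n) ⟩
        ≡⟨ ⟨⟩-cong (power-P (suc n)) (Q-∙ 1 (1 + n)) ⟨
      ⟨ power (regularᴷ 1) (regularᴳ 1) (2 + n) , Q 1 GA.∙ Q (1 + n) ⟩
        ≡⟨ ⟨power,q∙⟩ (regularᴷ 1) (regularᴳ 1) (1 + n) (Q (1 + n)) ⟩
      + (2 + n) ℤ.* (⟨ P 1 , Q 1 ⟩ ℤ.* ⟨ power (regularᴷ 1) (regularᴳ 1) (1 + n) , Q (1 + n) ⟩)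
        ≡⟨ cong (+ (2 + n) ℤ.*_) (cong₂ ℤ._*_ (⟨P,Q⟩-dim 1) (trans (⟨⟩-cong (power-P n) GAʳ.refl) (⟨P,Q⟩-dim (1 + n)))) ⟩
      + (2 + n) ℤ.* (+ dim 1 ℤ.* + dim (1 + n))
        ≡⟨ cong (+ (2 + n) ℤ.*_) (ℤ.pos-* (dim 1) (dim (1 + n))) ⟨
      + (2 + n) ℤ.* + (dim 1 * dim (1 + n))
        ≡⟨ ℤ.pos-* (2 + n) (dim 1 * dim (1 + n)) ⟨
      + ((2 + n) * (dim 1 * dim (1 + n))) ∎)
      where open ≡-Reasoning

    dim-formula : ∀ n → dim n ≡ dim 1 ^ n * n !
    dim-formula zero          = dim-zero
    dim-formula (suc zero)    = sym (trans (ℕ.*-identityʳ _) (ℕ.*-identityʳ (dim 1)))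
    dim-formula (suc (suc n)) = begin
      dim (2 + n)                                          ≡⟨ dim-suc n ⟩
      (2 + n) * (dim 1 * dim (1 + n))                      ≡⟨ cong (λ d → (2 + n) * (dim 1 * d)) (dim-formula (suc n)) ⟩
      (2 + n) * (dim 1 * (dim 1 ^ (1 + n) * (1 + n) !))    ≡⟨ rearrange (2 + n) (dim 1) (dim 1 ^ (1 + n)) ((1 + n) !) ⟩
      dim 1 ^ (2 + n) * (2 + n) !                          ∎
      where
      open ≡-Reasoning
      rearrange : ∀ m r s f → m * (r * (s * f)) ≡ r * s * (m * f)
      rearrange = ℕ-Solver.solve-∀

theorem1p1 : (A : Towers.Tower ℂ) → Towers.FormDualHopfAlgebras ℂ A → ∀ n → Towers.Tower.dim A n ≡ Towers.Tower.dim A 1 ^ n * n !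
theorem1p1 = DualHopfTower.dim-formula ℂ
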